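{- There are a constant $c$ and a computable function $g$ such that every instance $I=(V,f_1,\dots,f_k,d)$ of Robust Submodular Minimizer can be solved in $|\arg\min f_1|\cdot g(d)\cdot n^{c}$ time, where $n=|I|$ is the input size.
   Context: Here $\mathbb{N}$ contains $0$, $[k]=\{1,\dots,k\}$, and $\triangle$ denotes symmetric difference. A function $f:2^V\to\mathbb{R}$ is submodular if $f(X)+f(Y)\ge f(X\cup Y)+f(X\cap Y)$ for all $X,Y\subseteq V$; $\arg\min f=\{Y\subseteq V: f(Y)\le f(Y')\ \forall Y'\subseteq V\}$ is its set of minimizers. Robust Submodular Minimizer: the input is a finite set $V$, submodular functions $f_1,\dots,f_k:2^V\to\mathbb{R}$, and $d\in\mathbb{N}$; the task is to find a set $X\subseteq V$ such that for each $i\in[k]$ there exists $Y_i\in\arg\min f_i$ with $|X\triangle Y_i|\le d$, or detect that no such set exists. Each $f_i$ is given via a compact representation of the distributive lattice $\mathcal{L}_i=\arg\min f_i$. A compact representation of a distributive lattice $\mathcal{L}\subseteq 2^V$ (a family closed under union and intersection) consists of a partition of $V$ into $U_0,U_1,\dots,U_b,U_\infty$ (with $U_0,U_\infty$ possibly empty) such that every set in $\mathcal{L}$ contains $U_0$, is disjoint from $U_\infty$, and is of the form $U_0\cup\bigcup_{j\in J}U_j$ for some $J\subseteq[b]$, together with a directed acyclic graph $G(\mathcal{L})$ with vertex set $\{U_0,\dots,U_b\}$ whose unique sink (vertex of out-degree zero) is $U_0$ and such that a non-empty set $Z$ of vertices of $G(\mathcal{L})$ has no out-going edge if and only if $\bigcup_{U_j\in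 Z}U_j\in\mathcal{L}$. -}

module Defs where

open import Data.Bool.Base using (Bool; true; false)
open import Data.Fin.Base using (Fin; zero; suc)
open import Data.Fin.Subset
  using (Subset; inside; outside; _∈_; _⊆_; _∪_; _∩_; _─_; ⁅_⁆; ∣_∣; Empty; Nonempty)
open import Data.List.Base as List using (List; []; _∷_)
import Data.List.Membership.Propositional as List
open import Data.List.Relation.Unary.Unique.Propositional using (Unique)
open import Data.Maybe.Base using (Maybe; just; nothing; maybe′; is-nothing)
open import Data.Nat.Base using (ℕ; zero; suc; _+_; _≤_)
open import Data.Nat.Binary.Base as ℕᵇ using (ℕᵇ; 2[1+_]; 1+[2_])
open import Data.Product.Base using (∃-syntax; _×_)
open import Data.Rational.Base as ℚ using (ℚ; 1ℚ; ½)
import Data.Rational.Properties as ℚ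
open import Data.Rational.Solver using (module +-*-Solver)
open import Data.Vec.Base as Vec using (Vec; []; _∷_; lookup; tabulate)
open import Function.Bundles using (_⇔_)
open import Relation.Binary.Construct.Closure.Transitive using (TransClosure)
open import Relation.Binary.PropositionalEquality.Core using (_≡_; refl; cong)
open import Relation.Nullary.Negation.Core using (¬_)

------------------------------------------------------------------------
-- Real numbers, as rapidly converging Cauchy sequences of rationals

2⁻ : ℕ → ℚ
2⁻ zero    = 1ℚ
2⁻ (suc n) = ½ ℚ.* 2⁻ n

record ℝ : Set where
  field
    approx : ℕ → ℚ
    cauchy : ∀ m n → ℚ.∣ approx m ℚ.- approx n ∣ ℚ.≤ 2⁻ m ℚ.+ 2⁻ n

open ℝ public

-- The n-th approximation is within 2⁻ n of the limit, which is where
-- the slack 2⁻ n + 2⁻ n comes from.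
infix 4 _≤ℝ_
_≤ℝ_ : ℝ → ℝ → Set
x ≤ℝ y = ∀ n → approx x n ℚ.≤ approx y n ℚ.+ (2⁻ n ℚ.+ 2⁻ n)

-- Shifting the index by one halves the error of each summand.
infixl 6 _+ℝ_
_+ℝ_ : ℝ → ℝ → ℝ
approx (x +ℝ y) n = approx x (suc n) ℚ.+ approx y (suc n)
cauchy (x +ℝ y) m n = begin
  ℚ.∣ (a ℚ.+ b) ℚ.- (a′ ℚ.+ b′) ∣
    ≡⟨ cong ℚ.∣_∣ (solve 4 (λ a b a′ b′ →
         (a :+ b) :- (a′ :+ b′) := (a :- a′) :+ (b :- b′)) refl a b a′ b′) ⟩
  ℚ.∣ (a ℚ.- a′) ℚ.+ (b ℚ.- b′) ∣
    ≤⟨ ℚ.∣p+q∣≤∣p∣+∣q∣ (a ℚ.- a′) (b ℚ.- b′) ⟩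
  ℚ.∣ a ℚ.- a′ ∣ ℚ.+ ℚ.∣ b ℚ.- b′ ∣
    ≤⟨ ℚ.+-mono-≤ (cauchy x (suc m) (suc n)) (cauchy y (suc m) (suc n)) ⟩
  (½ ℚ.* 2⁻ m ℚ.+ ½ ℚ.* 2⁻ n) ℚ.+ (½ ℚ.* 2⁻ m ℚ.+ ½ ℚ.* 2⁻ n)
    ≡⟨ solve 2 (λ u v →
         (con ½ :* u :+ con ½ :* v) :+ (con ½ :* u :+ con ½ :* v) := u :+ v)
         refl (2⁻ m) (2⁻ n) ⟩
  2⁻ m ℚ.+ 2⁻ n ∎
  where
  open ℚ.≤-Reasoning
  open +-*-Solver
  a  = approx x (suc m)
  b  = approx y (suc m)
  a′ = approx x (suc n)
  b′ = approx y (suc n)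

------------------------------------------------------------------------
-- Submodular functions on the subsets of V = Fin m

Submodular : ∀ {m} → (Subset m → ℝ) → Set
Submodular f = ∀ X Y → f (X ∪ Y) +ℝ f (X ∩ Y) ≤ℝ f X +ℝ f Y

ArgMin : ∀ {m} → (Subset m → ℝ) → Subset m → Set
ArgMin f Y = ∀ Y′ → f Y ≤ℝ f Y′

infixl 5 _△_
_△_ : ∀ {m} → Subset m → Subset m → Subset m
X △ Y = (X ─ Y) ∪ (Y ─ X)

HasCardinality : ∀ {m} → (Subset m → Set) → ℕ → Set
HasCardinality {m} P N =
  ∃[ xs ] Unique xs × (∀ Y → (Y List.∈ xs) ⇔ P Y) × List.length xs ≡ N

------------------------------------------------------------------------
-- Compact representations

-- The part of the representation that is given to an algorithm.  The
-- partition is stored as the map sending each element of V to (the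
-- index of) its block, with nothing standing for U∞.
record RepData (m : ℕ) : Set where
  field
    b     : ℕ
    block : Fin m → Maybe (Fin (suc b))
    edge  : Fin (suc b) → Fin (suc b) → Bool

  ⋃U : Subset (suc b) → Subset m
  ⋃U Z = tabulate λ v → maybe′ (lookup Z) outside (block v)

  U : Fin (suc b) → Subset m
  U j = ⋃U ⁅ j ⁆

  U∞ : Subset m
  U∞ = tabulate λ v → is-nothing (block v)

  Edge : Fin (suc b) → Fin (suc b) → Set
  Edge i j = edge i j ≡ true

  NoOutgoing : Subset (suc b) → Set
  NoOutgoing Z = ∀ {i j} → i ∈ Z → Edge i j → j ∈ Z

record IsCompactRep {m} (L : Subset m → Set) (R : RepData m) : Set where
  open RepData R
  field
    block-nonempty : ∀ (j : Fin b) → Nonempty (U (suc j))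
    contains-U₀    : ∀ {Y} → L Y → U zero ⊆ Y
    avoids-U∞      : ∀ {Y} → L Y → Empty (Y ∩ U∞)
    union-form     : ∀ {Y} → L Y → ∃[ J ] Y ≡ ⋃U (inside ∷ J)
    acyclic        : ∀ j → ¬ TransClosure Edge j j
    unique-sink    : ∀ j → (∀ j′ → ¬ Edge j j′) ⇔ j ≡ zero
    closed⇒member  : ∀ Z → Nonempty Z → NoOutgoing Z → L (⋃U Z)
    -- The hypothesis zero ∈ Z follows from L (⋃U Z) when U₀ is nonempty.
    -- When U₀ is empty, Z and {U₀} ∪ Z have the same union, so only the
    -- latter can be required to have no outgoing edge.
    member⇒closed  : ∀ Z → zero ∈ Z → L (⋃U Z) → NoOutgoing Z

------------------------------------------------------------------------
-- Robust Submodular Minimizer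

-- k-1 is one less than the number k of functions; as the first function
-- plays a special role, k is at least 1.
record Instance : Set where
  field
    m          : ℕ
    k-1        : ℕ
    f          : Fin (suc k-1) → Subset m → ℝ
    submodular : ∀ i → Submodular (f i)
    d          : ℕ
    rep        : Fin (suc k-1) → RepData m
    isRep      : ∀ i → IsCompactRep (ArgMin (f i)) (rep i)

  IsSolution : Subset m → Set
  IsSolution X = ∀ i → ∃[ Y ] ArgMin (f i) Y × ∣ X △ Y ∣ ≤ d

------------------------------------------------------------------------
-- Encoding of inputs and outputs as binary trees

infixr 5 _∙_
data Tree : Set where
  nil : Tree
  _∙_ : Tree → Tree → Tree

size : Tree → ℕ
size nil     = 1
size (s ∙ t) = suc (size s + size t)

encodeBool : Bool → Tree
encodeBool false = nil
encodeBool true  = nil ∙ nil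

encodeList : List Tree → Tree
encodeList = List.foldr _∙_ nil

encodeSubset : ∀ {m} → Subset m → Tree
encodeSubset X = encodeList (List.map encodeBool (Vec.toList X))

encodeℕᵇ : ℕᵇ → Tree
encodeℕᵇ ℕᵇ.zero  = nil
encodeℕᵇ 2[1+ x ] = encodeBool false ∙ encodeℕᵇ x
encodeℕᵇ 1+[2 x ] = encodeBool true ∙ encodeℕᵇ x

encodeℕ : ℕ → Tree
encodeℕ x = encodeℕᵇ (ℕᵇ.fromℕ x)

encodeRep : ∀ {m} → RepData m → Tree
encodeRep R =
  encodeSubset U∞
  ∙ encodeList (List.tabulate λ j → encodeSubset (U j))
  ∙ encodeList (List.tabulate λ i → encodeSubset (tabulate (edge i)))
  where open RepData R

-- The functions themselves are not part of the input, only the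
-- representations of their sets of minimizers are.
encodeInstance : Instance → Tree
encodeInstance I = encodeℕ d ∙ encodeList (List.tabulate λ i → encodeRep (rep i))
  where open Instance I

∣_∣ᴵ : Instance → ℕ
∣ I ∣ᴵ = size (encodeInstance I)

encodeResult : ∀ {m} → Maybe (Subset m) → Tree
encodeResult nothing  = nil
encodeResult (just X) = nil ∙ encodeSubset X

data Correct (I : Instance) : Maybe (Subset (Instance.m I)) → Set where
  found : ∀ {X} → Instance.IsSolution I X → Correct I (just X)
  none  : (∀ X → ¬ Instance.IsSolution I X) → Correct I nothing

------------------------------------------------------------------------
-- Model of computation: first-order, call-by-value recursive functions
-- on binary trees

-- An expression with n free variables, over function symbols of the
-- given arities.  In case e e₁ e₂, the branch e₂ binds the left subtree
-- (variable 0) and the right subtree (variable 1) of the value of e.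
data Expr {p : ℕ} (arity : Fin p → ℕ) (n : ℕ) : Set where
  var   : Fin n → Expr arity n
  nil   : Expr arity n
  _∙_   : Expr arity n → Expr arity n → Expr arity n
  case  : Expr arity n → Expr arity n → Expr arity (suc (suc n)) → Expr arity n
  let′  : Expr arity n → Expr arity (suc n) → Expr arity n
  call  : (h : Fin p) → Vec (Expr arity n) (arity h) → Expr arity n

record Program : Set where
  field
    p     : ℕ
    arity : Fin p → ℕ
    body  : (h : Fin p) → Expr arity (arity h)
    main  : Expr arity 1

-- ρ ⊢ e ⇓ v ⟨ t ⟩: in the environment ρ, e evaluates to v in t steps.
-- Each step takes, for a fixed program, constant time on a pointer
-- machine or RAM that represents a tree by a pointer to a pair of
-- pointers: the environment has bounded length and trees are shared,
-- never copied.
module _ (P : Program) where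
  open Program P

  infix 4 _⊢_⇓_⟨_⟩ _⊢_⇓*_⟨_⟩

  data _⊢_⇓_⟨_⟩ {n} (ρ : Vec Tree n) : Expr arity n → Tree → ℕ → Set
  data _⊢_⇓*_⟨_⟩ {n} (ρ : Vec Tree n) :
    ∀ {l} → Vec (Expr arity n) l → Vec Tree l → ℕ → Set

  data _⊢_⇓_⟨_⟩ {n} ρ where
    ⇓-var      : ∀ x → ρ ⊢ var x ⇓ lookup ρ x ⟨ 1 ⟩
    ⇓-nil      : ρ ⊢ nil ⇓ nil ⟨ 1 ⟩
    ⇓-∙        : ∀ {e e′ v v′ t t′} →
                 ρ ⊢ e ⇓ v ⟨ t ⟩ → ρ ⊢ e′ ⇓ v′ ⟨ t′ ⟩ →
                 ρ ⊢ e ∙ e′ ⇓ v ∙ v′ ⟨ suc (t + t′) ⟩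
    ⇓-case-nil : ∀ {e e₁ e₂ v t t′} →
                 ρ ⊢ e ⇓ nil ⟨ t ⟩ → ρ ⊢ e₁ ⇓ v ⟨ t′ ⟩ →
                 ρ ⊢ case e e₁ e₂ ⇓ v ⟨ suc (t + t′) ⟩
    ⇓-case-∙   : ∀ {e e₁ e₂ l r v t t′} →
                 ρ ⊢ e ⇓ l ∙ r ⟨ t ⟩ → (l ∷ r ∷ ρ) ⊢ e₂ ⇓ v ⟨ t′ ⟩ →
                 ρ ⊢ case e e₁ e₂ ⇓ v ⟨ suc (t + t′) ⟩
    ⇓-let      : ∀ {e e′ u v t t′} →
                 ρ ⊢ e ⇓ u ⟨ t ⟩ → (u ∷ ρ) ⊢ e′ ⇓ v ⟨ t′ ⟩ →
                 ρ ⊢ let′ e e′ ⇓ v ⟨ suc (t + t′) ⟩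
    ⇓-call     : ∀ {h es us v t t′} →
                 ρ ⊢ es ⇓* us ⟨ t ⟩ → us ⊢ body h ⇓ v ⟨ t′ ⟩ →
                 ρ ⊢ call h es ⇓ v ⟨ suc (t + t′) ⟩

  data _⊢_⇓*_⟨_⟩ {n} ρ where
    []  : ρ ⊢ [] ⇓* [] ⟨ 0 ⟩
    _∷_ : ∀ {l e v t t′} {es : Vec (Expr arity n) l} {vs} →
          ρ ⊢ e ⇓ v ⟨ t ⟩ → ρ ⊢ es ⇓* vs ⟨ t′ ⟩ →
          ρ ⊢ e ∷ es ⇓* v ∷ vs ⟨ t + t′ ⟩

  Runs : Tree → Tree → ℕ → Set
  Runs input output t = (input ∷ []) ⊢ main ⇓ output ⟨ t ⟩

Computable : (ℕ → ℕ) → Set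
Computable g = ∃[ P ] ∀ x → ∃[ t ] Runs P (encodeℕ x) (encodeℕ (g x)) t

module Submission where

-- Membership in a lattice given by a compact representation is a family of
-- constraints "if p ∈ Y then q ∈ Y", "q ∈ Y" and "p ∉ Y".  If Y violates one
-- of them, then Y disagrees with every member at p or at q.  Hence a member
-- within distance d of X is reached by d rounds of flipping, in all possible
-- ways, the at most two positions of some violated constraint; that is a
-- search among 3 ^ d sets.  If it fails and X′ is a set that does lie within
-- distance d of the lattice, then X and X′ differ at one of the at most
-- 2 * 3 ^ d positions met by the search, since otherwise the same search would
-- fail from X′.  So flipping these positions is in turn a complete local
-- search for a solution, started d rounds away at a minimizer of the first
-- function.  These are enumerated by branching on one position after the other
-- and discarding the branches without a member.

open import Defs
open import Algebra.Properties.CommutativeSemigroup using (interchange)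
open import Data.Bool.Base using (true; false; not; T; _∧_; if_then_else_)
open import Data.Bool.Properties using () renaming (_≟_ to _≟ᵇ_)
open import Data.Empty as Empty using (⊥-elim)
open import Data.Fin.Base using (Fin; zero; suc)
open import Data.Fin.Properties using (_≟_)
open import Data.Fin.Subset
  using (Subset; inside; outside; _∈_; _∉_; _⊆_; _∩_; ∁; ⁅_⁆; ∣_∣; Empty; ⊤)
open import Data.Fin.Subset.Properties
  using ( _∈?_; _⊆?_; ⊆-antisym; x∈p∩q⁺; x∈p∩q⁻; x∈⁅x⁆; x∈⁅y⁆⇒x≡y; x∉p⇒x∈∁p; x∈∁p⇒x∉p
        ; ∈⊤; ∣p∣≤n; ∣p∣≡n⇒p≡⊤)
open import Data.List.Base as List using (List; []; _∷_; _++_; length; map; filter; fromMaybe)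
open import Data.List.Membership.Propositional using () renaming (_∈_ to _∈ˡ_)
open import Data.List.Membership.Propositional.Properties
  using (∈-++⁺ˡ; ∈-++⁺ʳ; ∈-map⁺; ∈-map⁻; ∈-filter⁺; ∈-filter⁻; ∈-length)
open import Data.List.Properties using (length-++; length-map)
open import Data.List.Relation.Unary.All using (All; []; _∷_)
open import Data.List.Relation.Unary.Any using (here; there)
open import Data.List.Relation.Unary.Unique.Propositional using (Unique; []; _∷_)
import Data.List.Relation.Unary.Unique.Propositional.Properties as Unique
open import Data.Maybe.Base as Maybe using (Maybe; just; nothing; maybe′; _<∣>_)
open import Data.Nat.Base
  using (ℕ; zero; suc; _+_; _*_; _^_; _≤_; _≤ᵇ_; z≤n; s≤s; s≤s⁻¹; NonZero)
open import Data.Nat.Binary.Base as ℕᵇ using (2[1+_]; 1+[2_])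
import Data.Nat.Binary.Properties as ℕᵇ
open import Data.Nat.Properties hiding (_≟_)
open import Data.Nat.Tactic.RingSolver using (solve-∀)
open import Data.Product.Base using (∃-syntax; _×_; _,_; proj₁; proj₂)
open import Data.Sum.Base as Sum using (_⊎_; inj₁; inj₂)
open import Data.Vec.Base as Vec using (Vec; []; _∷_; lookup; tabulate; updateAt; here; there)
open import Data.Vec.Properties
  using ([]=⇒lookup; lookup⇒[]=; lookup∘tabulate; lookup∘updateAt; lookup∘updateAt′; ∷-injectiveʳ)
open import Function.Base using (_∘_; case_of_; const; id)
open import Function.Bundles using (mk⇔; Equivalence)
open import Level using (0ℓ)
open import Relation.Binary.PropositionalEquality
open import Relation.Nullary using (¬_; yes; no; contradiction)
open import Relation.Nullary.Decidable using (_×-dec_)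
open import Relation.Unary using (Pred; Decidable)

-- As the time may grow only linearly with the number of minimizers, the enumeration must not hold
-- many more states than that at any stage, so its pruning has to be exact. It can be: apart from
-- those for `U∞`, all constraints are implications with a single conclusion, hence a least closed
-- superset exists, and it alone decides whether a branch still has a member. Each outer round
-- multiplies the number of sets by at most `1 + 2 * 3 ^ d`, so `d` rounds give 2 ^ O(d²) sets per
-- start, and testing one of them costs only 2 ^ O(d) times a polynomial. Neither the value of `d`,
-- which is given in binary, nor the number of minimizers is polynomial in the input size. Costs are
-- therefore kept as a numeral plus a symbolic part, times a power of `n`; only loops whose length
-- is at most `n` are charged to that power.

-- Flips and distances of subsets.

flip : ∀ {m} → Subset m → Fin m → Subset m
flip X p = updateAt X p not

set : ∀ {m} → Subset m → Fin m → Subset m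
set X p = updateAt X p (const true)

Differ : ∀ {m} → Subset m → Subset m → Fin m → Set
Differ X Y p = lookup X p ≢ lookup Y p

-- A flip shared by both sets preserves agreement everywhere. So a difference met late in a search
-- that applies the same flips to two sets was there from the start.
flip-differ : ∀ {m} (X Y : Subset m) p {q} → Differ (flip X p) (flip Y p) q → Differ X Y q
flip-differ X Y p {q} X≢Y X≡Y with q ≟ p
... | yes refl = X≢Y (trans (lookup∘updateAt p X) (trans (cong not X≡Y) (sym (lookup∘updateAt p Y))))
... | no q≢p   = X≢Y (trans (lookup∘updateAt′ q p q≢p X) (trans X≡Y (sym (lookup∘updateAt′ q p q≢p Y))))

∈∉⇒differ : ∀ {m} {X Y : Subset m} {p} → p ∈ X → p ∉ Y → Differ X Y p
∈∉⇒differ {Y = Y} {p} p∈X p∉Y X≡Y = p∉Y (lookup⇒[]= p Y (trans (sym X≡Y) ([]=⇒lookup p∈X)))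

dist : ∀ {m} → Subset m → Subset m → ℕ
dist X Y = ∣ X △ Y ∣

dist-refl : ∀ {m} (X : Subset m) → dist X X ≡ 0
dist-refl []          = refl
dist-refl (false ∷ X) = dist-refl X
dist-refl (true ∷ X)  = dist-refl X

dist-sym : ∀ {m} (X Y : Subset m) → dist X Y ≡ dist Y X
dist-sym []          []          = refl
dist-sym (false ∷ X) (false ∷ Y) = dist-sym X Y
dist-sym (false ∷ X) (true ∷ Y)  = cong suc (dist-sym X Y)
dist-sym (true ∷ X)  (false ∷ Y) = cong suc (dist-sym X Y)
dist-sym (true ∷ X)  (true ∷ Y)  = dist-sym X Y

dist≡0⇒≡ : ∀ {m} (X Y : Subset m) → dist X Y ≤ 0 → X ≡ Y
dist≡0⇒≡ []          []          _ = refl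
dist≡0⇒≡ (false ∷ X) (false ∷ Y) h = cong (false ∷_) (dist≡0⇒≡ X Y h)
dist≡0⇒≡ (true ∷ X)  (true ∷ Y)  h = cong (true ∷_) (dist≡0⇒≡ X Y h)

dist-flip : ∀ {m} (X Y : Subset m) p → dist X (flip Y p) ≤ suc (dist X Y)
dist-flip (false ∷ X) (false ∷ Y) zero    = ≤-refl
dist-flip (false ∷ X) (true ∷ Y)  zero    = m≤n⇒m≤1+n (n≤1+n _)
dist-flip (true ∷ X)  (false ∷ Y) zero    = m≤n⇒m≤1+n (n≤1+n _)
dist-flip (true ∷ X)  (true ∷ Y)  zero    = ≤-refl
dist-flip (false ∷ X) (false ∷ Y) (suc p) = dist-flip X Y p
dist-flip (false ∷ X) (true ∷ Y)  (suc p) = s≤s (dist-flip X Y p)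
dist-flip (true ∷ X)  (false ∷ Y) (suc p) = s≤s (dist-flip X Y p)
dist-flip (true ∷ X)  (true ∷ Y)  (suc p) = dist-flip X Y p

dist-flip-differ : ∀ {m} (X Y : Subset m) p → Differ X Y p → suc (dist (flip X p) Y) ≡ dist X Y
dist-flip-differ (false ∷ X) (false ∷ Y) zero    h = contradiction refl h
dist-flip-differ (false ∷ X) (true ∷ Y)  zero    h = refl
dist-flip-differ (true ∷ X)  (false ∷ Y) zero    h = refl
dist-flip-differ (true ∷ X)  (true ∷ Y)  zero    h = contradiction refl h
dist-flip-differ (false ∷ X) (false ∷ Y) (suc p) h = dist-flip-differ X Y p h
dist-flip-differ (false ∷ X) (true ∷ Y)  (suc p) h = cong suc (dist-flip-differ X Y p h)
dist-flip-differ (true ∷ X)  (false ∷ Y) (suc p) h = cong suc (dist-flip-differ X Y p h)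
dist-flip-differ (true ∷ X)  (true ∷ Y)  (suc p) h = dist-flip-differ X Y p h

-- Local search guided by an oracle.

infixr 5 _orElse_
_orElse_ : ∀ {A : Set} → List A → List A → List A
[]       orElse ys = ys
(x ∷ xs) orElse ys = x ∷ xs

-- A combinator instead of a `with`, so that `select` unfolds to a term in which the oracle's answer
-- can be generalised to a variable.
ifNull : ∀ {A B : Set} → List A → B → B → B
ifNull []      x y = x
ifNull (_ ∷ _) x y = y

branch : ∀ {m} → Subset m → List (Fin m) → List (Subset m) → List (Subset m)
branch Y []       acc = acc
branch Y (p ∷ ps) acc = flip Y p ∷ branch Y ps acc

branch-flip : ∀ {m} {Y : Subset m} {p ps acc} → p ∈ˡ ps → flip Y p ∈ˡ branch Y ps acc
branch-flip (here refl) = here refl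
branch-flip (there p∈)  = there (branch-flip p∈)

branch-acc : ∀ {m} {Y Z : Subset m} {acc} ps → Z ∈ˡ acc → Z ∈ˡ branch Y ps acc
branch-acc []       Z∈ = Z∈
branch-acc (_ ∷ ps) Z∈ = there (branch-acc ps Z∈)

branch⁻ : ∀ {m} {Y Z : Subset m} {acc} ps → Z ∈ˡ branch Y ps acc → (∃[ p ] Z ≡ flip Y p) ⊎ Z ∈ˡ acc
branch⁻ []       Z∈          = inj₂ Z∈
branch⁻ (p ∷ ps) (here refl) = inj₁ (p , refl)
branch⁻ (p ∷ ps) (there Z∈)  = branch⁻ ps Z∈

-- Local search.  An oracle o returns the empty list on the sets sought
-- and, on any other set Y, positions one of which is wrong in Y.
module Search {m} (o : Subset m → List (Fin m)) where

  -- Each set is kept beside its flips, so that a set reached before the last round is still present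
  -- at the end. This makes the growth factor one more than the number of positions per answer.
  step : List (Subset m) → List (Subset m)
  step []       = []
  step (Y ∷ Ys) = Y ∷ branch Y (o Y) (step Ys)

  spread : ℕ → List (Subset m) → List (Subset m)
  spread zero    Ys = Ys
  spread (suc s) Ys = spread s (step Ys)

  select : List (Subset m) → Maybe (Subset m)
  select []       = nothing
  select (Y ∷ Ys) = ifNull (o Y) (just Y) (select Ys)

  collect : List (Subset m) → List (Fin m)
  collect []       = []
  collect (Y ∷ Ys) = o Y ++ collect Ys

  step-⊇ : ∀ {Z Ys} → Z ∈ˡ Ys → Z ∈ˡ step Ys
  step-⊇                (here refl) = here refl
  step-⊇ {Ys = Y ∷ Ys} (there Z∈)  = there (branch-acc (o Y) (step-⊇ Z∈))

  step-flip : ∀ {Y Ys p} → Y ∈ˡ Ys → p ∈ˡ o Y → flip Y p ∈ˡ step Ys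
  step-flip                (here refl) p∈ = there (branch-flip p∈)
  step-flip {Ys = Y ∷ Ys} (there Y∈)  p∈ = there (branch-acc (o Y) (step-flip Y∈ p∈))

  step⁻ : ∀ {Z} Ys → Z ∈ˡ step Ys → ∃[ Y ] Y ∈ˡ Ys × (∀ X → dist X Z ≤ suc (dist X Y))
  step⁻ (Y ∷ Ys) (here refl) = Y , here refl , λ X → n≤1+n _
  step⁻ (Y ∷ Ys) (there Z∈) with branch⁻ (o Y) Z∈
  ... | inj₁ (p , refl) = Y , here refl , λ X → dist-flip X Y p
  ... | inj₂ Z∈step with step⁻ Ys Z∈step
  ...   | Y′ , Y′∈ , near = Y′ , there Y′∈ , near

  spread-⊇ : ∀ s {Z Ys} → Z ∈ˡ Ys → Z ∈ˡ spread s Ys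
  spread-⊇ zero    Z∈ = Z∈
  spread-⊇ (suc s) Z∈ = spread-⊇ s (step-⊇ Z∈)

  -- Quantifying over every `X` stands in for the triangle inequality: the bounds compose along the
  -- rounds, and `X` is chosen as the start only at the end.
  spread-near : ∀ s {Z Ys} → Z ∈ˡ spread s Ys → ∃[ Y ] Y ∈ˡ Ys × (∀ X → dist X Z ≤ s + dist X Y)
  spread-near zero    {Z} Z∈ = Z , Z∈ , λ X → ≤-refl
  spread-near (suc s) {Z} {Ys} Z∈ with spread-near s Z∈
  ... | Y′ , Y′∈ , near with step⁻ Ys Y′∈
  ...   | Y , Y∈ , near′ = Y , Y∈ , λ X → begin
    dist X Z              ≤⟨ near X ⟩
    s + dist X Y′         ≤⟨ +-monoʳ-≤ s (near′ X) ⟩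
    s + suc (dist X Y)    ≡⟨ +-suc s _ ⟩
    suc (s + dist X Y)    ∎
    where open ≤-Reasoning

  -- All that completeness asks of an oracle, relative to one target `Z`. The oracle may accept sets
  -- other than `Z`.
  Hits : Subset m → Subset m → Set
  Hits Z Y = o Y ≡ [] ⊎ ∃[ p ] p ∈ˡ o Y × Differ Y Z p

  -- The same flips are applied to Y and to Y′, which keeps the positions
  -- where the two differ and moves Y′ towards Z.
  spread-complete : ∀ s {Ys} Y Y′ Z → (∀ X → Hits Z X) → Y ∈ˡ Ys → dist Y′ Z ≤ s →
    ∃[ X ] X ∈ˡ spread s Ys × (o X ≡ [] ⊎ ∃[ p ] p ∈ˡ o X × Differ Y Y′ p)
  spread-complete zero Y Y′ Z hits Y∈ near with dist≡0⇒≡ Y′ Z near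
  ... | refl = Y , Y∈ , hits Y
  spread-complete (suc s) Y Y′ Z hits Y∈ near with hits Y
  ... | inj₁ done = Y , spread-⊇ (suc s) Y∈ , inj₁ done
  ... | inj₂ (p , p∈ , Y≢Z) with lookup Y p ≟ᵇ lookup Y′ p
  ...   | no Y≢Y′  = Y , spread-⊇ (suc s) Y∈ , inj₂ (p , p∈ , Y≢Y′)
  ...   | yes Y≡Y′ with spread-complete s (flip Y p) (flip Y′ p) Z hits (step-flip Y∈ p∈)
                         (s≤s⁻¹ (≤-trans (≤-reflexive (dist-flip-differ Y′ Z p (Y≢Z ∘ trans Y≡Y′))) near))
  ...     | X , X∈ , inj₁ done            = X , X∈ , inj₁ done
  ...     | X , X∈ , inj₂ (q , q∈ , diff) = X , X∈ , inj₂ (q , q∈ , flip-differ Y Y′ p diff)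

  select-just : ∀ Ys {Y} → select Ys ≡ just Y → Y ∈ˡ Ys × o Y ≡ []
  select-just (Y ∷ Ys) eq with o Y in oY
  select-just (Y ∷ Ys) refl | []    = here refl , oY
  select-just (Y ∷ Ys) eq   | _ ∷ _ with select-just Ys eq
  ... | Y∈ , good = there Y∈ , good

  select-nothing : ∀ Ys {Y} → select Ys ≡ nothing → Y ∈ˡ Ys → o Y ≢ []
  select-nothing (Y ∷ Ys) eq Y∈ good with o Y in oY
  select-nothing (Y ∷ Ys) eq (here refl) good | _ ∷ _ with () ← trans (sym oY) good
  select-nothing (Y ∷ Ys) eq (there Y∈)  good | _ ∷ _ = select-nothing Ys eq Y∈ good

  ∈-collect : ∀ Ys {Y p} → Y ∈ˡ Ys → p ∈ˡ o Y → p ∈ˡ collect Ys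
  ∈-collect (Y ∷ Ys) (here refl) p∈ = ∈-++⁺ˡ p∈
  ∈-collect (Y ∷ Ys) (there Y∈)  p∈ = ∈-++⁺ʳ (o Y) (∈-collect Ys Y∈ p∈)

  module _ (d : ℕ) where

    -- The empty list means success, so `repair` is an oracle again. On failure the positions of all
    -- searched sets are returned, since any of these sets may be the one that reveals a difference.
    repair : Subset m → List (Fin m)
    repair X = maybe′ (const []) (collect (spread d (X ∷ []))) (select (spread d (X ∷ [])))

    repair-sound : ∀ X → repair X ≡ [] → ∃[ Z ] o Z ≡ [] × dist X Z ≤ d
    repair-sound X eq with select (spread d (X ∷ [])) in sel
    ... | just Z with select-just (spread d (X ∷ [])) sel
    ...   | Z∈ , good with spread-near d Z∈
    ...     | _ , here refl , near = Z , good , ≤-trans (near X)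
                (≤-reflexive (trans (cong (d +_) (dist-refl X)) (+-identityʳ d)))
    -- As `X` is among the searched sets, an empty `collect` forces `o X` to be empty, and then `X`
    -- itself serves.
    repair-sound X eq | nothing with o X in oX
    ... | []    = X , oX , ≤-trans (≤-reflexive (dist-refl X)) z≤n
    ... | p ∷ _ with () ← subst (p ∈ˡ_) eq (∈-collect (spread d (X ∷ [])) {X} (spread-⊇ d (here refl))
                                            (subst (p ∈ˡ_) (sym oX) (here refl)))

    -- This turns `Hits` for `o` with target `Z` into `Hits` for `repair` with any target `X′` near
    -- `Z`. When the search from `X` accepts nothing, `spread-complete` is left with the alternative
    -- that lists a difference between `X` and `X′`.
    repair-hits : ∀ X X′ Z → (∀ Y → Hits Z Y) → dist X′ Z ≤ d →
                  repair X ≡ [] ⊎ ∃[ p ] p ∈ˡ repair X × Differ X X′ p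
    repair-hits X X′ Z hits near with select (spread d (X ∷ [])) in sel
    ... | just _  = inj₁ refl
    ... | nothing with spread-complete d X X′ Z hits (here refl) near
    ...   | Y , Y∈ , inj₁ good            = contradiction good (select-nothing _ sel Y∈)
    ...   | Y , Y∈ , inj₂ (p , p∈ , diff) = inj₂ (p , ∈-collect _ Y∈ p∈ , diff)

-- Trying several oracles in turn.

firstNonempty : ∀ {A : Set} k → (Fin k → List A) → List A
firstNonempty zero    T = []
firstNonempty (suc k) T = T zero orElse firstNonempty k (T ∘ suc)

firstNonempty≡[] : ∀ {A : Set} k {T : Fin k → List A} → firstNonempty k T ≡ [] → ∀ i → T i ≡ []
firstNonempty≡[] (suc k) {T} eq i with T zero in Tz
firstNonempty≡[] (suc k) {T} eq zero    | [] = Tz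
firstNonempty≡[] (suc k) {T} eq (suc i) | [] = firstNonempty≡[] k eq i

-- The result is either empty or one of the lists `T i`. It serves both to pass on `Hits` and to
-- bound the number of positions.
firstNonempty-either : ∀ {A : Set} k {T : Fin k → List A} (P : List A → Set) →
  (∀ i → T i ≡ [] ⊎ P (T i)) → firstNonempty k T ≡ [] ⊎ P (firstNonempty k T)
firstNonempty-either zero    P h = inj₁ refl
firstNonempty-either (suc k) {T} P h with T zero | h zero
... | []    | _       = firstNonempty-either k P (h ∘ suc)
... | _ ∷ _ | inj₂ px = inj₂ px

-- Violated constraints

find : ∀ {m} → Subset m → Subset m → Maybe (Fin m)
find []      []      = nothing
find (a ∷ A) (b ∷ B) = if a ∧ b then just zero else Maybe.map suc (find A B)

find-just : ∀ {m} (A B : Subset m) {p} → find A B ≡ just p → p ∈ A × p ∈ B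
find-just (true ∷ A) (true ∷ B) refl = here , here
find-just (true ∷ A) (false ∷ B) eq with find A B in h
find-just (true ∷ A) (false ∷ B) refl | just p with find-just A B h
... | p∈A , p∈B = there p∈A , there p∈B
find-just (false ∷ A) (b ∷ B) eq with find A B in h
find-just (false ∷ A) (b ∷ B) refl | just p with find-just A B h
... | p∈A , p∈B = there p∈A , there p∈B

find-nothing : ∀ {m} (A B : Subset m) {p} → find A B ≡ nothing → p ∈ A → p ∉ B
find-nothing (true ∷ A) (true ∷ B) () here here
find-nothing (a ∷ A) (b ∷ B) eq (there p∈A) (there p∈B) with a ∧ b
... | false with find A B in h
...   | nothing = find-nothing A B h p∈A p∈B

-- The missing element `q` comes first because `grow` adds the head of the list.
link : ∀ {A : Set} → Maybe A → Maybe A → List A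
link (just p) (just q) = q ∷ p ∷ []
link (just p) nothing  = []
link nothing  _        = []

rowScan : ∀ {k m} → Subset k → (Fin k → Subset m) → Subset m → Maybe (Fin m)
rowScan []      V N = nothing
rowScan (r ∷ R) V N = (if r then find (V zero) N else nothing) <∣> rowScan R (V ∘ suc) N

-- `U` and `V` start as the same family of blocks; the recursion uses up the rows of `U` and `E`
-- while `V` stays whole. What block `i` requires of `Y` depends only on whether it meets `Y`, so
-- one witness `p` per row is enough.
pairScan : ∀ {l k m} → (Fin l → Subset m) → (Fin l → Subset k) → (Fin k → Subset m) →
           Subset m → Subset m → List (Fin m)
pairScan {zero}  U E V Y N = []
pairScan {suc l} U E V Y N =
  link (find (U zero) Y) (find (U zero) N <∣> rowScan (E zero) V N)
  orElse pairScan (U ∘ suc) (E ∘ suc) V Y N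

rowScan-just : ∀ {k m} (R : Subset k) (V : Fin k → Subset m) N {q} → rowScan R V N ≡ just q →
               q ∈ N × ∃[ j ] j ∈ R × q ∈ V j
rowScan-just (true ∷ R) V N eq with find (V zero) N in h
rowScan-just (true ∷ R) V N refl | just q with find-just (V zero) N h
... | q∈V , q∈N = q∈N , zero , here , q∈V
rowScan-just (true ∷ R) V N eq | nothing with rowScan-just R (V ∘ suc) N eq
... | q∈N , j , j∈R , q∈V = q∈N , suc j , there j∈R , q∈V
rowScan-just (false ∷ R) V N eq with rowScan-just R (V ∘ suc) N eq
... | q∈N , j , j∈R , q∈V = q∈N , suc j , there j∈R , q∈V

rowScan-nothing : ∀ {k m} (R : Subset k) (V : Fin k → Subset m) N {j q} → rowScan R V N ≡ nothing →
                  j ∈ R → q ∈ V j → q ∉ N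
rowScan-nothing (true ∷ R) V N eq j∈R q∈V with find (V zero) N in h
rowScan-nothing (true ∷ R) V N eq here        q∈V | nothing = find-nothing _ N h q∈V
rowScan-nothing (true ∷ R) V N eq (there j∈R) q∈V | nothing = rowScan-nothing R (V ∘ suc) N eq j∈R q∈V
rowScan-nothing (false ∷ R) V N eq (there j∈R) q∈V = rowScan-nothing R (V ∘ suc) N eq j∈R q∈V

module _ {l k m} (U : Fin l → Subset m) (E : Fin l → Subset k) (V : Fin k → Subset m) where

  Reaches : Fin l → Fin m → Set
  Reaches i q = q ∈ U i ⊎ ∃[ j ] j ∈ E i × q ∈ V j

  data Broken (Y N : Subset m) : List (Fin m) → Set where
    broken : ∀ i {p q} → p ∈ U i → p ∈ Y → q ∈ N → Reaches i q → Broken Y N (q ∷ p ∷ [])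

  Intact : Subset m → Subset m → Set
  Intact Y N = ∀ {i p q} → p ∈ U i → p ∈ Y → q ∈ N → ¬ Reaches i q

pairScan-spec : ∀ {l k m} (U : Fin l → Subset m) (E : Fin l → Subset k) V Y N →
  (pairScan U E V Y N ≡ [] × Intact U E V Y N) ⊎ Broken U E V Y N (pairScan U E V Y N)
pairScan-spec {zero}  U E V Y N = inj₁ (refl , λ { {()} })
pairScan-spec {suc l} {k} U E V Y N = go (find (U zero) Y) refl
  where
  Spec : List _ → Set
  Spec xs = (xs ≡ [] × Intact U E V Y N) ⊎ Broken U E V Y N xs

  below : (∀ {p q} → p ∈ U zero → p ∈ Y → q ∈ N → ¬ Reaches U E V zero q) →
          Spec (pairScan (U ∘ suc) (E ∘ suc) V Y N)
  below clear with pairScan-spec (U ∘ suc) (E ∘ suc) V Y N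
  ... | inj₁ (eq , intact) = inj₁ (eq , λ { {zero} → clear ; {suc i} → intact })
  ... | inj₂ b = inj₂ (shift b)
    where
    shift : ∀ {xs} → Broken (U ∘ suc) (E ∘ suc) V Y N xs → Broken U E V Y N xs
    shift (broken i p∈U p∈Y q∈N r) = broken (suc i) p∈U p∈Y q∈N r

  go : ∀ p → find (U zero) Y ≡ p →
       Spec (link p (find (U zero) N <∣> rowScan (E zero) V N) orElse pairScan (U ∘ suc) (E ∘ suc) V Y N)
  go nothing  hp = below λ p∈U p∈Y _ _ → find-nothing _ _ hp p∈U p∈Y
  go (just p) hp with find-just _ _ hp | find (U zero) N in hq
  ... | p∈U , p∈Y | just q = inj₂ (broken zero p∈U p∈Y (proj₂ q∈) (inj₁ (proj₁ q∈)))
    where q∈ = find-just _ _ hq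
  ... | p∈U , p∈Y | nothing with rowScan (E zero) V N in hr
  ...   | just q = inj₂ (broken zero p∈U p∈Y (proj₁ q∈) (inj₂ (proj₂ q∈)))
    where q∈ = rowScan-just (E zero) V N hr
  ...   | nothing = below λ where
    _ _ q∈N (inj₁ q∈U)             → find-nothing _ _ hq q∈U q∈N
    _ _ q∈N (inj₂ (j , j∈E , q∈V)) → rowScan-nothing (E zero) V N hr j∈E q∈V q∈N

-- A compact representation as a system of constraints.

module Rep {m} (R : RepData m) where
  open RepData R

  -- The case `i ≡ j` expresses that a block is never split.
  Link : Fin (suc b) → Fin (suc b) → Set
  Link i j = i ≡ j ⊎ Edge i j

  record Closed (Y : Subset m) : Set where
    field
      base : U zero ⊆ Y
      step : ∀ i j {p q} → Link i j → p ∈ U i → q ∈ U j → p ∈ Y → q ∈ Y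

  data Forced (Y : Subset m) : List (Fin m) → Set where
    initial : ∀ {q} → q ∈ U zero → q ∉ Y → Forced Y (q ∷ [])
    implied : ∀ i j {p q} → Link i j → p ∈ U i → q ∈ U j → p ∈ Y → q ∉ Y → Forced Y (q ∷ p ∷ [])

  E : Fin (suc b) → Subset (suc b)
  E i = tabulate (edge i)

  -- The constraints for `U∞` are left out here: the remaining ones only ever force elements in,
  -- which is what makes closures possible.
  defect : Subset m → List (Fin m)
  defect Y = fromMaybe (find (U zero) (∁ Y)) orElse pairScan U E U Y (∁ Y)

  violation : Subset m → List (Fin m)
  violation Y = defect Y orElse fromMaybe (find U∞ Y)

  ∈E⁻ : ∀ {i j} → j ∈ E i → Edge i j
  ∈E⁻ {i} {j} j∈ = trans (sym (lookup∘tabulate (edge i) j)) ([]=⇒lookup j∈)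

  ∈E⁺ : ∀ {i j} → Edge i j → j ∈ E i
  ∈E⁺ {i} {j} e = lookup⇒[]= j (E i) (trans (lookup∘tabulate (edge i) j) e)

  decide∈ : ∀ {Y : Subset m} {q} → ¬ q ∈ ∁ Y → q ∈ Y
  decide∈ {Y} {q} h with q ∈? Y
  ... | yes q∈ = q∈
  ... | no q∉  = contradiction (x∉p⇒x∈∁p q∉) h

  defect-spec : ∀ Y → (defect Y ≡ [] × Closed Y) ⊎ Forced Y (defect Y)
  defect-spec Y = combine (find (U zero) (∁ Y)) refl (pairScan-spec U E U Y (∁ Y))
    where
    combine : ∀ q {xs} → find (U zero) (∁ Y) ≡ q →
              (xs ≡ [] × Intact U E U Y (∁ Y)) ⊎ Broken U E U Y (∁ Y) xs →
              (fromMaybe q orElse xs ≡ [] × Closed Y) ⊎ Forced Y (fromMaybe q orElse xs)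
    combine (just q) h _ = inj₂ (initial (proj₁ q∈) (x∈∁p⇒x∉p (proj₂ q∈)))
      where q∈ = find-just _ _ h
    combine nothing h (inj₁ (refl , intact)) = inj₁ (refl , record
      { base = λ q∈U → decide∈ λ q∈∁ → find-nothing _ _ h q∈U q∈∁
      ; step = λ where
          i _ (inj₁ refl) p∈U q∈U p∈Y → decide∈ λ q∈∁ → intact {i} p∈U p∈Y q∈∁ (inj₁ q∈U)
          i j (inj₂ e)    p∈U q∈U p∈Y → decide∈ λ q∈∁ → intact {i} p∈U p∈Y q∈∁ (inj₂ (j , ∈E⁺ e , q∈U))
      })
    combine nothing h (inj₂ (broken i p∈U p∈Y q∈∁ (inj₁ q∈U))) =
      inj₂ (implied i i (inj₁ refl) p∈U q∈U p∈Y (x∈∁p⇒x∉p q∈∁))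
    combine nothing h (inj₂ (broken i p∈U p∈Y q∈∁ (inj₂ (j , j∈E , q∈V)))) =
      inj₂ (implied i j (inj₂ (∈E⁻ j∈E)) p∈U q∈V p∈Y (x∈∁p⇒x∉p q∈∁))

  forced-hits : ∀ {Y Z xs} → Closed Z → Forced Y xs → ∃[ p ] p ∈ˡ xs × Differ Y Z p
  forced-hits cl (initial q∈U q∉Y) = _ , here refl , ∈∉⇒differ (Closed.base cl q∈U) q∉Y ∘ sym
  forced-hits {Y} {Z} cl (implied i j {p} ij p∈U q∈U p∈Y q∉Y) with p ∈? Z
  ... | yes p∈Z = _ , here refl , ∈∉⇒differ (Closed.step cl i j ij p∈U q∈U p∈Z) q∉Y ∘ sym
  ... | no p∉Z  = _ , there (here refl) , ∈∉⇒differ p∈Y p∉Z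

  Feasible : Subset m → Set
  Feasible Y = Closed Y × Empty (Y ∩ U∞)

  violation≡[]⇒feasible : ∀ Y → violation Y ≡ [] → Feasible Y
  violation≡[]⇒feasible Y eq with defect Y | defect-spec Y
  ... | _ | inj₁ (refl , closed) with find U∞ Y in h
  ...   | nothing = closed , λ { (p , p∈) → find-nothing _ _ h (proj₂ (x∈p∩q⁻ Y U∞ p∈)) (proj₁ (x∈p∩q⁻ Y U∞ p∈)) }
  violation≡[]⇒feasible Y () | _ | inj₂ (initial _ _)
  violation≡[]⇒feasible Y () | _ | inj₂ (implied _ _ _ _ _ _ _)

  violation-hits : ∀ {Z} → Feasible Z → ∀ Y → Search.Hits violation Z Y
  violation-hits {Z} (closed , avoids) Y with defect Y | defect-spec Y
  ... | _ | inj₂ f@(initial _ _)         = inj₂ (forced-hits closed f)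
  ... | _ | inj₂ f@(implied _ _ _ _ _ _ _) = inj₂ (forced-hits closed f)
  ... | _ | inj₁ (refl , _) with find U∞ Y in h
  ...   | nothing = inj₁ refl
  ...   | just p  = inj₂ (p , here refl , ∈∉⇒differ (proj₂ p∈) λ p∈Z → avoids (p , x∈p∩q⁺ (p∈Z , proj₁ p∈)))
    where p∈ = find-just U∞ Y h

  -- Take the set as its own target in `violation-hits`: it cannot differ from itself.
  feasible⇒violation≡[] : ∀ {Y} → Feasible Y → violation Y ≡ []
  feasible⇒violation≡[] {Y} feas with violation-hits feas Y
  ... | inj₁ eq            = eq
  ... | inj₂ (_ , _ , Y≢Y) = contradiction refl Y≢Y

  violation-length : ∀ Y → length (violation Y) ≤ 2
  violation-length Y with defect Y | defect-spec Y
  ... | _ | inj₂ (initial _ _)         = s≤s z≤n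
  ... | _ | inj₂ (implied _ _ _ _ _ _ _) = s≤s (s≤s z≤n)
  ... | _ | inj₁ (refl , _) with find U∞ Y
  ...   | nothing = z≤n
  ...   | just _  = s≤s z≤n

  ∈⋃U⁺ : ∀ {Z p i} → block p ≡ just i → i ∈ Z → p ∈ ⋃U Z
  ∈⋃U⁺ {Z} {p} eq i∈Z = lookup⇒[]= p _ (trans (lookup∘tabulate _ p) (trans (cong (maybe′ (lookup Z) outside) eq) ([]=⇒lookup i∈Z)))

  ∈⋃U⁻ : ∀ {Z p} → p ∈ ⋃U Z → ∃[ i ] block p ≡ just i × i ∈ Z
  ∈⋃U⁻ {Z} {p} p∈ with block p | trans (sym (lookup∘tabulate (λ v → maybe′ (lookup Z) outside (block v)) p)) ([]=⇒lookup p∈)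
  ... | just i | eq = i , refl , lookup⇒[]= i Z eq

  ∈U⁺ : ∀ {p i} → block p ≡ just i → p ∈ U i
  ∈U⁺ {i = i} eq = ∈⋃U⁺ eq (x∈⁅x⁆ i)

  ∈U⁻ : ∀ i {p} → p ∈ U i → block p ≡ just i
  ∈U⁻ i p∈ with ∈⋃U⁻ {⁅ i ⁆} p∈
  ... | j , eq , j∈ = trans eq (cong just (x∈⁅y⁆⇒x≡y i j∈))

  ∈U∞ : ∀ {p} → block p ≡ nothing → p ∈ U∞
  ∈U∞ {p} eq = lookup⇒[]= p U∞ (trans (lookup∘tabulate _ p) (cong Maybe.is-nothing eq))

  module _ {L : Subset m → Set} (isRep : IsCompactRep L R) where
    open IsCompactRep isRep

    member⇒feasible : ∀ {Y} → L Y → Feasible Y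
    member⇒feasible {Y} LY with union-form LY
    ... | J , refl = record { base = contains-U₀ LY ; step = step } , avoids-U∞ LY
      where
      step : ∀ i j {p q} → Link i j → p ∈ U i → q ∈ U j → p ∈ Y → q ∈ Y
      step i j ij p∈U q∈U p∈Y with ∈⋃U⁻ {inside ∷ J} p∈Y
      ... | i′ , eq , i∈Z with trans (sym eq) (∈U⁻ i p∈U)
      step i j (inj₁ refl) p∈U q∈U p∈Y | i , eq , i∈Z | refl = ∈⋃U⁺ (∈U⁻ j q∈U) i∈Z
      -- `union-form` always includes block `zero` in the index set, and `here` supplies exactly
      -- this condition of `member⇒closed`.
      step i j (inj₂ e)    p∈U q∈U p∈Y | i , eq , i∈Z | refl = ∈⋃U⁺ (∈U⁻ j q∈U) (member⇒closed _ here LY i∈Z e)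

    feasible⇒member : ∀ {Y} → Feasible Y → L Y
    feasible⇒member {Y} (closed , avoids) = subst L (⊆-antisym ⋃Z⊆Y Y⊆⋃Z) (closed⇒member Z (zero , here) noOut)
      where
      open Closed closed
      v : Fin b → Fin m
      v j = proj₁ (block-nonempty j)
      -- A closed set contains all or nothing of a block, so one representative decides. Block
      -- `zero` is included outright, as it may be empty and have no representative.
      Z : Subset (suc b)
      Z = inside ∷ tabulate (lookup Y ∘ v)
      ∈Z⁻ : ∀ {j} → suc j ∈ Z → v j ∈ Y
      ∈Z⁻ {j} (there j∈) = lookup⇒[]= (v j) Y (trans (sym (lookup∘tabulate (lookup Y ∘ v) j)) ([]=⇒lookup j∈))
      ∈Z⁺ : ∀ {j} → v j ∈ Y → suc j ∈ Z
      ∈Z⁺ {j} v∈ = there (lookup⇒[]= j _ (trans (lookup∘tabulate (lookup Y ∘ v) j) ([]=⇒lookup v∈)))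
      noOut : NoOutgoing Z
      noOut {zero}  {j}     _  e = contradiction e (Equivalence.from (unique-sink zero) refl j)
      noOut {suc i} {zero}  _  _ = here
      noOut {suc i} {suc j} i∈ e = ∈Z⁺ (step (suc i) (suc j) (inj₂ e) (proj₂ (block-nonempty i)) (proj₂ (block-nonempty j)) (∈Z⁻ i∈))
      ⋃Z⊆Y : ⋃U Z ⊆ Y
      ⋃Z⊆Y p∈ with ∈⋃U⁻ {Z} p∈
      ... | zero  , eq , _  = base (∈U⁺ eq)
      ... | suc j , eq , j∈ = step (suc j) (suc j) (inj₁ refl) (proj₂ (block-nonempty j)) (∈U⁺ eq) (∈Z⁻ j∈)
      Y⊆⋃Z : Y ⊆ ⋃U Z
      Y⊆⋃Z {p} p∈ with block p in eq
      ... | nothing      = contradiction (p , x∈p∩q⁺ (p∈ , ∈U∞ eq)) avoids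
      ... | just zero    = ∈⋃U⁺ eq here
      ... | just (suc j) = ∈⋃U⁺ eq (∈Z⁺ (step (suc j) (suc j) (inj₁ refl) (∈U⁺ eq) (proj₂ (block-nonempty j)) p∈))

    -- This makes the number of minimizers at least 1, which lets it absorb additive constants in
    -- the cost.
    nonempty : ∃[ Y ] L Y
    nonempty = ⋃U ⊤ , closed⇒member ⊤ (zero , ∈⊤) (λ _ _ → ∈⊤)

-- Enumeration of the members

∈-flip⁺ : ∀ {m} {Y : Subset m} {p q} → q ∉ Y → p ∈ Y → p ∈ flip Y q
∈-flip⁺ {Y = Y} {p} {q} q∉Y p∈Y with p ≟ q
... | yes refl = contradiction p∈Y q∉Y
... | no p≢q   = lookup⇒[]= p _ (trans (lookup∘updateAt′ p q p≢q Y) ([]=⇒lookup p∈Y))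

∈-flip⁻ : ∀ {m} {Y : Subset m} {p q} → p ∈ flip Y q → p ≡ q ⊎ p ∈ Y
∈-flip⁻ {Y = Y} {p} {q} p∈ with p ≟ q
... | yes p≡q = inj₁ p≡q
... | no p≢q  = inj₂ (lookup⇒[]= p Y (trans (sym (lookup∘updateAt′ p q p≢q Y)) ([]=⇒lookup p∈)))

∣flip∣ : ∀ {m} (Y : Subset m) q → q ∉ Y → ∣ flip Y q ∣ ≡ suc ∣ Y ∣
∣flip∣ (true ∷ Y)  zero    q∉ = contradiction here q∉
∣flip∣ (false ∷ Y) zero    q∉ = refl
∣flip∣ (true ∷ Y)  (suc q) q∉ = cong suc (∣flip∣ Y q (q∉ ∘ there))
∣flip∣ (false ∷ Y) (suc q) q∉ = ∣flip∣ Y q (q∉ ∘ there)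

set-∈ : ∀ {m} {Y : Subset m} {p} → p ∈ set Y p
set-∈ {Y = Y} {p} = lookup⇒[]= p _ (lookup∘updateAt p Y)

set-⊇ : ∀ {m} {Y : Subset m} {p} → Y ⊆ set Y p
set-⊇ {Y = Y} {p} {q} q∈ with q ≟ p
... | yes refl = set-∈
... | no q≢p   = lookup⇒[]= q _ (trans (lookup∘updateAt′ q p q≢p Y) ([]=⇒lookup q∈))

set-⊆ : ∀ {m} {Y Z : Subset m} {p} → p ∈ Z → Y ⊆ Z → set Y p ⊆ Z
set-⊆ {Y = Y} {Z} {p} p∈Z Y⊆Z {q} q∈ with q ≟ p
... | yes refl = p∈Z
... | no q≢p   = Y⊆Z (lookup⇒[]= q Y (trans (sym (lookup∘updateAt′ q p q≢p Y)) ([]=⇒lookup q∈)))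

positions : ∀ m → List (Fin m)
positions zero    = []
positions (suc m) = zero ∷ map suc (positions m)

∈-positions : ∀ {m} (p : Fin m) → p ∈ˡ positions m
∈-positions zero    = here refl
∈-positions (suc p) = there (∈-map⁺ suc (∈-positions p))

length-positions : ∀ m → length (positions m) ≡ m
length-positions zero    = refl
length-positions (suc m) = cong suc (trans (length-map suc (positions m)) (length-positions m))

-- A device for counting members; the program never runs through it.
subsets : ∀ m → List (Subset m)
subsets zero    = [] ∷ []
subsets (suc m) = map (true ∷_) (subsets m) ++ map (false ∷_) (subsets m)

∈-subsets : ∀ {m} (Y : Subset m) → Y ∈ˡ subsets m
∈-subsets []          = here refl
∈-subsets (true ∷ Y)  = ∈-++⁺ˡ (∈-map⁺ (true ∷_) (∈-subsets Y))
∈-subsets {suc m} (false ∷ Y) = ∈-++⁺ʳ (map (true ∷_) (subsets m)) (∈-map⁺ (false ∷_) (∈-subsets Y))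

subsets-unique : ∀ m → Unique (subsets m)
subsets-unique zero    = [] ∷ []
subsets-unique (suc m) =
  Unique.++⁺ (Unique.map⁺ ∷-injectiveʳ (subsets-unique m)) (Unique.map⁺ ∷-injectiveʳ (subsets-unique m)) disjoint
  where
  disjoint : ∀ {Y} → ¬ (Y ∈ˡ map (true ∷_) (subsets m) × Y ∈ˡ map (false ∷_) (subsets m))
  disjoint (Y∈₁ , Y∈₂) with ∈-map⁻ _ Y∈₁ | ∈-map⁻ _ Y∈₂
  ... | _ , _ , refl | _ , _ , ()

length-filter-split : ∀ {A : Set} {P Q₁ Q₂ : Pred A 0ℓ} (P? : Decidable P) (Q₁? : Decidable Q₁) (Q₂? : Decidable Q₂) →
  (∀ {x} → Q₁ x → P x) → (∀ {x} → Q₂ x → P x) → (∀ {x} → Q₁ x → ¬ Q₂ x) →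
  ∀ xs → length (filter Q₁? xs) + length (filter Q₂? xs) ≤ length (filter P? xs)
length-filter-split P? Q₁? Q₂? Q₁⇒P Q₂⇒P disjoint [] = z≤n
length-filter-split P? Q₁? Q₂? Q₁⇒P Q₂⇒P disjoint (x ∷ xs)
  with ih ← length-filter-split P? Q₁? Q₂? Q₁⇒P Q₂⇒P disjoint xs
  with Q₁? x | Q₂? x | P? x
... | yes q₁ | yes q₂ | _      = contradiction q₂ (disjoint q₁)
... | yes q₁ | no _   | yes _  = s≤s ih
... | yes q₁ | no _   | no ¬p  = contradiction (Q₁⇒P q₁) ¬p
... | no _   | yes q₂ | yes _  = ≤-trans (≤-reflexive (+-suc _ _)) (s≤s ih)
... | no _   | yes q₂ | no ¬p  = contradiction (Q₂⇒P q₂) ¬p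
... | no _   | no _   | yes _  = m≤n⇒m≤1+n ih
... | no _   | no _   | no _   = ih

module Enumeration {m} (R : RepData m) where
  open RepData R
  open Rep R

  grow : Subset m → Subset m
  grow Y with defect Y
  ... | []    = Y
  ... | q ∷ _ = flip Y q

  close : ℕ → Subset m → Subset m
  close zero    Y = Y
  close (suc s) Y = grow (close s Y)

  forced-head : ∀ {Y q xs} → Forced Y (q ∷ xs) → q ∉ Y × (∀ {Z} → Closed Z → Y ⊆ Z → q ∈ Z)
  forced-head (initial q∈U q∉Y)                 = q∉Y , λ cl _ → Closed.base cl q∈U
  forced-head (implied i j ij p∈U q∈U p∈Y q∉Y) = q∉Y , λ cl Y⊆Z → Closed.step cl i j ij p∈U q∈U (Y⊆Z p∈Y)

  grow-⊇ : ∀ Y → Y ⊆ grow Y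
  grow-⊇ Y with defect Y | defect-spec Y
  ... | []    | _      = id
  ... | q ∷ _ | inj₂ f = ∈-flip⁺ (proj₁ (forced-head f))

  grow-least : ∀ {Y Z} → Closed Z → Y ⊆ Z → grow Y ⊆ Z
  grow-least {Y} cl Y⊆Z p∈ with defect Y | defect-spec Y
  ... | []    | _      = Y⊆Z p∈
  ... | q ∷ _ | inj₂ f with ∈-flip⁻ p∈
  ...   | inj₁ refl = proj₂ (forced-head f) cl Y⊆Z
  ...   | inj₂ p∈Y  = Y⊆Z p∈Y

  grow-size : ∀ Y → Closed Y ⊎ ∣ grow Y ∣ ≡ suc ∣ Y ∣
  grow-size Y with defect Y | defect-spec Y
  ... | []    | inj₁ (_ , cl) = inj₁ cl
  ... | q ∷ _ | inj₂ f        = inj₂ (∣flip∣ Y q (proj₁ (forced-head f)))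

  grow-closed : ∀ {Y} → Closed Y → grow Y ≡ Y
  grow-closed {Y} cl with defect Y | defect-spec Y
  ... | []    | _      = refl
  ... | q ∷ _ | inj₂ f = contradiction (proj₂ (forced-head f) cl id) (proj₁ (forced-head f))

  close-⊇ : ∀ s Y → Y ⊆ close s Y
  close-⊇ zero    Y = id
  close-⊇ (suc s) Y = grow-⊇ (close s Y) ∘ close-⊇ s Y

  close-least : ∀ s {Y Z} → Closed Z → Y ⊆ Z → close s Y ⊆ Z
  close-least zero    cl Y⊆Z = Y⊆Z
  close-least (suc s) cl Y⊆Z = grow-least cl (close-least s cl Y⊆Z)

  -- Every round that does not start from a closed set adds an element. Hence after `m` rounds the
  -- set is closed or contains every position, and in the latter case it is closed trivially.
  close-progress : ∀ s Y → Closed (close s Y) ⊎ s ≤ ∣ close s Y ∣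
  close-progress zero    Y = inj₂ z≤n
  close-progress (suc s) Y with close-progress s Y
  ... | inj₁ cl = inj₁ (subst Closed (sym (grow-closed cl)) cl)
  ... | inj₂ s≤ with grow-size (close s Y)
  ...   | inj₁ cl = inj₁ (subst Closed (sym (grow-closed cl)) cl)
  ...   | inj₂ eq = inj₂ (≤-trans (s≤s s≤) (≤-reflexive (sym eq)))

  close-closed : ∀ Y → Closed (close m Y)
  close-closed Y with close-progress m Y
  ... | inj₁ cl = cl
  ... | inj₂ m≤ = record { base = λ _ → all ; step = λ _ _ _ _ _ _ → all }
    where
    all : ∀ {p} → p ∈ close m Y
    all {p} = subst (p ∈_) (sym (∣p∣≡n⇒p≡⊤ (≤-antisym (∣p∣≤n (close m Y)) m≤))) ∈⊤

  State : Set
  State = Subset m × Subset m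

  -- A state (Y , F) stands for the members that contain Y and avoid F.  It is
  -- kept only if the least closed superset of Y is one of them, so that the
  -- states kept split the members into nonempty classes.
  tryAdd : State → List State → List State
  tryAdd s acc = maybe′ (const acc) (s ∷ acc) (find (close m (proj₁ s)) (proj₂ s))

  expand : Fin m → List State → List State
  expand p []             = []
  expand p ((Y , F) ∷ ss) = tryAdd (set Y p , F) (tryAdd (Y , set F p) (expand p ss))

  enum : List (Fin m) → List State
  enum []       = (U zero , U∞) ∷ []
  enum (p ∷ ps) = expand p (enum ps)

  starts : List (Subset m)
  starts = map proj₁ (enum (positions m))

  feasible? : Decidable Feasible
  feasible? Y with violation Y in eq
  ... | []    = yes (violation≡[]⇒feasible Y eq)
  ... | _ ∷ _ = no λ feas → case trans (sym eq) (feasible⇒violation≡[] feas) of λ ()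

  members : List (Subset m)
  members = filter feasible? (subsets m)

  Fits : State → Subset m → Set
  Fits (Y , F) Z = Feasible Z × Y ⊆ Z × F ⊆ ∁ Z

  fits? : ∀ s → Decidable (Fits s)
  fits? (Y , F) Z = feasible? Z ×-dec Y ⊆? Z ×-dec F ⊆? ∁ Z

  count : State → ℕ
  count s = length (filter (fits? s) (subsets m))

  total : List State → ℕ
  total []       = 0
  total (s ∷ ss) = count s + total ss

  tryAdd-total : ∀ s ss → total (tryAdd s ss) ≤ count s + total ss
  tryAdd-total (Y , F) ss with find (close m Y) F
  ... | just _  = m≤n+m (total ss) _
  ... | nothing = ≤-refl

  AvoidU∞ : State → Set
  AvoidU∞ (Y , F) = U∞ ⊆ F

  -- A state that is kept has a member to pay for it: the closure of `Y` misses `F`, hence also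
  -- `U∞`, so it is feasible and counted.
  tryAdd-length : ∀ {s ss} → AvoidU∞ s → length ss ≤ total ss → length (tryAdd s ss) ≤ total (tryAdd s ss)
  tryAdd-length {s@(Y , F)} {ss} U∞⊆F ih with find (close m Y) F in h
  ... | just _  = ih
  ... | nothing = +-mono-≤ (∈-length fit) ih
    where
    avoids : ∀ {p} → p ∈ close m Y → p ∉ F
    avoids = find-nothing (close m Y) F h
    fit : close m Y ∈ˡ filter (fits? s) (subsets m)
    fit = ∈-filter⁺ (fits? s) (∈-subsets _)
      ( (close-closed Y , λ { (p , p∈) → avoids (proj₁ (x∈p∩q⁻ _ U∞ p∈)) (U∞⊆F (proj₂ (x∈p∩q⁻ (close m Y) U∞ p∈))) })
      , close-⊇ m Y , λ p∈F → x∉p⇒x∈∁p λ p∈ → avoids p∈ p∈F)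

  All-tryAdd : ∀ {P : State → Set} {s ss} → P s → All P ss → All P (tryAdd s ss)
  All-tryAdd {s = Y , F} ps pss with find (close m Y) F
  ... | just _  = pss
  ... | nothing = ps ∷ pss

  expand-avoid : ∀ p {ss} → All AvoidU∞ ss → All AvoidU∞ (expand p ss)
  expand-avoid p []         = []
  expand-avoid p (av ∷ avs) = All-tryAdd av (All-tryAdd (set-⊇ ∘ av) (expand-avoid p avs))

  enum-avoid : ∀ ps → All AvoidU∞ (enum ps)
  enum-avoid []       = id ∷ []
  enum-avoid (p ∷ ps) = expand-avoid p (enum-avoid ps)

  expand-length : ∀ p {ss} → All AvoidU∞ ss → length (expand p ss) ≤ total (expand p ss)
  expand-length p []                 = z≤n
  expand-length p (_∷_ {Y , F} {ss} av avs) =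
    tryAdd-length {ss = tryAdd (Y , set F p) (expand p ss)} av
      (tryAdd-length {ss = expand p ss} (set-⊇ ∘ av) (expand-length p avs))

  count-split : ∀ p Y F → count (set Y p , F) + count (Y , set F p) ≤ count (Y , F)
  count-split p Y F = length-filter-split (fits? (Y , F)) (fits? (set Y p , F)) (fits? (Y , set F p))
    (λ { (feas , Y⊆ , F⊆) → feas , Y⊆ ∘ set-⊇ , F⊆ })
    (λ { (feas , Y⊆ , F⊆) → feas , Y⊆ , F⊆ ∘ set-⊇ })
    (λ { (_ , Y⊆ , _) (_ , _ , F⊆) → x∈∁p⇒x∉p (F⊆ set-∈) (Y⊆ set-∈) })
    (subsets m)

  expand-total : ∀ p ss → total (expand p ss) ≤ total ss
  expand-total p []             = z≤n
  expand-total p ((Y , F) ∷ ss) = begin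
    total (tryAdd (set Y p , F) (tryAdd (Y , set F p) (expand p ss)))
      ≤⟨ tryAdd-total (set Y p , F) _ ⟩
    count (set Y p , F) + total (tryAdd (Y , set F p) (expand p ss))
      ≤⟨ +-monoʳ-≤ (count (set Y p , F)) (tryAdd-total (Y , set F p) _) ⟩
    count (set Y p , F) + (count (Y , set F p) + total (expand p ss))
      ≡⟨ +-assoc (count (set Y p , F)) _ _ ⟨
    count (set Y p , F) + count (Y , set F p) + total (expand p ss)
      ≤⟨ +-mono-≤ (count-split p Y F) (expand-total p ss) ⟩
    count (Y , F) + total ss ∎
    where open ≤-Reasoning

  enum-total : ∀ ps → total (enum ps) ≤ length members
  enum-total []       = begin
    count (U zero , U∞) + 0              ≡⟨ +-identityʳ _ ⟩
    count (U zero , U∞)                  ≤⟨ m≤m+n _ _ ⟩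
    -- With an empty second class, the splitting lemma becomes monotonicity.
    count (U zero , U∞) + length (filter no? (subsets m))
      ≤⟨ length-filter-split feasible? (fits? (U zero , U∞)) no? proj₁ ⊥-elim (λ _ ()) (subsets m) ⟩
    length members                       ∎
    where
    open ≤-Reasoning
    no? : Decidable (const Empty.⊥)
    no? _ = no λ ()
  enum-total (p ∷ ps) = ≤-trans (expand-total p (enum ps)) (enum-total ps)

  module _ {Z} (feas : Feasible Z) where

    root-fits : Fits (U zero , U∞) Z
    root-fits = feas , Closed.base (proj₁ feas) , λ p∈U∞ → x∉p⇒x∈∁p λ p∈Z → proj₂ feas (_ , x∈p∩q⁺ (p∈Z , p∈U∞))

    -- The closure of `Y` is the least closed superset, so it lies inside `Z` and misses `F` as `Z`
    -- does.
    tryAdd-here : ∀ {s} ss → Fits s Z → s ∈ˡ tryAdd s ss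
    tryAdd-here {Y , F} ss (_ , Y⊆Z , F⊆∁Z) with find (close m Y) F in h
    ... | nothing = here refl
    ... | just p  = contradiction (close-least m (proj₁ feas) Y⊆Z (proj₁ (find-just _ F h)))
                                  (x∈∁p⇒x∉p (F⊆∁Z (proj₂ (find-just (close m Y) F h))))

    tryAdd-there : ∀ {s t} ss → t ∈ˡ ss → t ∈ˡ tryAdd s ss
    tryAdd-there {Y , F} ss t∈ with find (close m Y) F
    ... | nothing = there t∈
    ... | just _  = t∈

    Decides : State → Fin m → Set
    Decides (Y , F) p = p ∈ Y ⊎ p ∈ F

    expand-complete : ∀ p {ss Y F} → (Y , F) ∈ˡ ss → Fits (Y , F) Z →
      ∃[ s ] s ∈ˡ expand p ss × Fits s Z × Decides s p × (∀ {q} → Decides (Y , F) q → Decides s q)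
    expand-complete p {_ ∷ ss} {Y} {F} (here refl) (_ , Y⊆Z , F⊆∁Z) with p ∈? Z
    ... | yes p∈Z = (set Y p , F) , tryAdd-here (tryAdd (Y , set F p) (expand p ss)) fits , fits , inj₁ set-∈ , Sum.map₁ set-⊇
      where
      fits : Fits (set Y p , F) Z
      fits = feas , set-⊆ p∈Z Y⊆Z , F⊆∁Z
    ... | no p∉Z = (Y , set F p) , tryAdd-there {set Y p , F} _ (tryAdd-here (expand p ss) fits) , fits , inj₂ set-∈ , Sum.map₂ set-⊇
      where
      fits : Fits (Y , set F p) Z
      fits = feas , Y⊆Z , set-⊆ (x∉p⇒x∈∁p p∉Z) F⊆∁Z
    expand-complete p {(Y′ , F′) ∷ ss} (there s∈) fits with expand-complete p s∈ fits
    ... | s , s∈′ , rest = s , tryAdd-there {set Y′ p , F′} _ (tryAdd-there {Y′ , set F′ p} _ s∈′) , rest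

    enum-complete : ∀ ps → ∃[ s ] s ∈ˡ enum ps × Fits s Z × (∀ {q} → q ∈ˡ ps → Decides s q)
    enum-complete []       = (U zero , U∞) , here refl , root-fits , λ ()
    enum-complete (p ∷ ps) with enum-complete ps
    ... | (Y , F) , s∈ , fits , dec with expand-complete p s∈ fits
    ...   | s , s∈′ , fits′ , p-dec , mono =
      s , s∈′ , fits′ , λ { (here refl) → p-dec ; (there q∈) → mono (dec q∈) }

    starts-complete : Z ∈ˡ starts
    starts-complete with enum-complete (positions m)
    ... | (Y , F) , s∈ , (_ , Y⊆Z , F⊆∁Z) , dec = subst (_∈ˡ starts) (⊆-antisym Y⊆Z Z⊆Y) (∈-map⁺ proj₁ s∈)
      where
      Z⊆Y : Z ⊆ Y
      Z⊆Y {p} p∈Z with dec (∈-positions p)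
      ... | inj₁ p∈Y = p∈Y
      ... | inj₂ p∈F = contradiction p∈Z (x∈∁p⇒x∉p (F⊆∁Z p∈F))

  -- The root state never passes the test of `tryAdd`, so the given feasible set pays for it. In all
  -- later lists every state is paid for by a member of its own class, and the classes are disjoint.
  enum-length : ∀ ps {Z} → Feasible Z → length (enum ps) ≤ length members
  enum-length []       feas = ∈-length (∈-filter⁺ feasible? (∈-subsets _) feas)
  enum-length (p ∷ ps) feas = ≤-trans (expand-length p (enum-avoid ps)) (enum-total (p ∷ ps))

-- Sizes of the searches.

shift-power : ∀ w p l → p * (w * l) ≡ w * p * l
shift-power = solve-∀

module SearchLength {m} (o : Subset m → List (Fin m)) (w : ℕ) (short : ∀ Y → length (o Y) ≤ w) where
  open Search o

  branch-length : ∀ (Y : Subset m) ps acc → length (branch Y ps acc) ≡ length ps + length acc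
  branch-length Y []       acc = refl
  branch-length Y (p ∷ ps) acc = cong suc (branch-length Y ps acc)

  step-length : ∀ Ys → length (step Ys) ≤ suc w * length Ys
  step-length []       = z≤n
  step-length (Y ∷ Ys) = s≤s (begin
    length (branch Y (o Y) (step Ys))  ≡⟨ branch-length Y (o Y) (step Ys) ⟩
    length (o Y) + length (step Ys)    ≤⟨ +-mono-≤ (short Y) (step-length Ys) ⟩
    w + suc w * length Ys              ≡⟨ regroup w (length Ys) ⟩
    length Ys + w * suc (length Ys)    ∎)
    where
    open ≤-Reasoning
    regroup : ∀ w l → w + suc w * l ≡ l + w * suc l
    regroup = solve-∀

  spread-length : ∀ s Ys → length (spread s Ys) ≤ suc w ^ s * length Ys
  spread-length zero    Ys = ≤-reflexive (sym (+-identityʳ _))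
  spread-length (suc s) Ys = begin
    length (spread s (step Ys))          ≤⟨ spread-length s (step Ys) ⟩
    suc w ^ s * length (step Ys)         ≤⟨ *-monoʳ-≤ (suc w ^ s) (step-length Ys) ⟩
    suc w ^ s * (suc w * length Ys)      ≡⟨ shift-power (suc w) (suc w ^ s) (length Ys) ⟩
    suc w ^ suc s * length Ys            ∎
    where open ≤-Reasoning

  collect-length : ∀ Ys → length (collect Ys) ≤ length Ys * w
  collect-length []       = z≤n
  collect-length (Y ∷ Ys) = ≤-trans (≤-reflexive (length-++ (o Y))) (+-mono-≤ (short Y) (collect-length Ys))

  repair-length : ∀ d X → length (repair d X) ≤ suc w ^ d * w
  repair-length d X with select (spread d (X ∷ []))
  ... | just _  = z≤n
  ... | nothing = begin
    length (collect (spread d (X ∷ [])))   ≤⟨ collect-length (spread d (X ∷ [])) ⟩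
    length (spread d (X ∷ [])) * w         ≤⟨ *-monoˡ-≤ w (spread-length d (X ∷ [])) ⟩
    suc w ^ d * 1 * w                      ≡⟨ cong (_* w) (*-identityʳ (suc w ^ d)) ⟩
    suc w ^ d * w                          ∎
    where open ≤-Reasoning

repairs : ∀ {m k} → ℕ → (Fin k → RepData m) → Subset m → List (Fin m)
repairs {k = k} d R X = firstNonempty k λ i → Search.repair (Rep.violation (R i)) d X

repairs-length : ∀ {m k} d (R : Fin k → RepData m) X → length (repairs d R X) ≤ 3 ^ d * 2
repairs-length {k = k} d R X with firstNonempty-either k (λ xs → length xs ≤ 3 ^ d * 2)
  (λ i → inj₂ (SearchLength.repair-length (Rep.violation (R i)) 2 (Rep.violation-length (R i)) d X))
... | inj₁ eq    = ≤-trans (≤-reflexive (cong length eq)) z≤n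
... | inj₂ short = short

-- The program

pattern v0  = var zero
pattern v1  = var (suc zero)
pattern v2  = var (suc (suc zero))
pattern v3  = var (suc (suc (suc zero)))
pattern v4  = var (suc (suc (suc (suc zero))))
pattern v5  = var (suc (suc (suc (suc (suc zero)))))
pattern v6  = var (suc (suc (suc (suc (suc (suc zero))))))
pattern v7  = var (suc (suc (suc (suc (suc (suc (suc zero)))))))
pattern v8  = var (suc (suc (suc (suc (suc (suc (suc (suc zero))))))))
pattern v9  = var (suc (suc (suc (suc (suc (suc (suc (suc (suc zero)))))))))
pattern v11 = var (suc (suc (suc (suc (suc (suc (suc (suc (suc (suc (suc zero)))))))))))

pattern findᶠ      = zero
pattern negᶠ       = suc findᶠ
pattern rowScanᶠ   = suc negᶠ
pattern pairScanᶠ  = suc rowScanᶠ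
pattern defectᶠ    = suc pairScanᶠ
pattern violationᶠ = suc defectᶠ
pattern flipᶠ      = suc violationᶠ
pattern setᶠ       = suc flipᶠ
pattern branchᶠ    = suc setᶠ
pattern oracleᶠ    = suc branchᶠ
pattern stepᶠ      = suc oracleᶠ
pattern spreadᶠ    = suc stepᶠ
pattern selectᶠ    = suc spreadᶠ
pattern appendᶠ    = suc selectᶠ
pattern collectᶠ   = suc appendᶠ
pattern repairᶠ    = suc collectᶠ
pattern repairsᶠ   = suc repairᶠ
pattern mapSucᶠ    = suc repairsᶠ
pattern positionsᶠ = suc mapSucᶠ
pattern closeᶠ     = suc positionsᶠ
pattern tryAddᶠ    = suc closeᶠ
pattern expandᶠ    = suc tryAddᶠ
pattern enumᶠ      = suc expandᶠ
pattern firstsᶠ    = suc enumᶠ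
pattern doubleᶠ    = suc firstsᶠ
pattern toUnaryᶠ   = suc doubleᶠ
pattern pow2ᶠ      = suc toUnaryᶠ
pattern incᶠ       = suc pow2ᶠ
pattern toBinaryᶠ  = suc incᶠ

arity : Fin 29 → ℕ
arity findᶠ      = 2
arity negᶠ       = 1
arity rowScanᶠ   = 3
arity pairScanᶠ  = 5
arity defectᶠ    = 2
arity violationᶠ = 2
arity flipᶠ      = 2
arity setᶠ       = 2
arity branchᶠ    = 3
arity oracleᶠ    = 2
arity stepᶠ      = 2
arity spreadᶠ    = 3
arity selectᶠ    = 2
arity appendᶠ    = 2
arity collectᶠ   = 2
arity repairᶠ    = 3
arity repairsᶠ   = 3
arity mapSucᶠ    = 1
arity positionsᶠ = 1
arity closeᶠ     = 3
arity tryAddᶠ    = 4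
arity expandᶠ    = 3
arity enumᶠ      = 2
arity firstsᶠ    = 1
arity doubleᶠ    = 1
arity toUnaryᶠ   = 1
arity pow2ᶠ      = 1
arity incᶠ       = 1
arity toBinaryᶠ  = 1

-- The comments list the variables in scope from that line on, variable 0 first.
body : (h : Fin 29) → Expr arity (arity h)
body findᶠ =                                       -- A, B
  case v0 nil (case v3 nil                         -- b, B′, a, A′, A, B
    -- An optional position is a list of length at most one; `(nil ∙ v0) ∙ nil` moves a position
    -- found in the tails past the heads.
    (let′ (case (call findᶠ (v3 ∷ v1 ∷ [])) nil ((nil ∙ v0) ∙ nil))
      (case v3 v0 (case v3 v2 (nil ∙ nil)))))
body negᶠ =
  case v0 nil (case v0 (nil ∙ nil) nil ∙ call negᶠ (v1 ∷ []))
body rowScanᶠ =                                    -- R, V, N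
  case v0 nil (case v3 nil                         -- V₀, V′, r, R′, R, V, N
    (let′ (call rowScanᶠ (v3 ∷ v1 ∷ v6 ∷ []))
      (case v3 v0 (case (call findᶠ (v3 ∷ v9 ∷ [])) v2 (v0 ∙ v1)))))
body pairScanᶠ =                                   -- U, E, V, Y, N
  case v0 nil (case v3 nil                         -- E₀, E′, U₀, U′, U, E, V, Y, N
    (let′ (call pairScanᶠ (v3 ∷ v1 ∷ v6 ∷ v7 ∷ v8 ∷ []))
      (case (call findᶠ (v3 ∷ v8 ∷ [])) v0         -- p, nil, rest, E₀, E′, U₀, U′, U, E, V, Y, N
        (case (case (call findᶠ (v5 ∷ v11 ∷ [])) (call rowScanᶠ (v3 ∷ v9 ∷ v11 ∷ [])) (v0 ∙ v1))
          v2 (v0 ∙ v2 ∙ nil)))))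
body defectᶠ =                                     -- rep, Y
  case v0 nil (case v1 nil                         -- U, E, U∞, U ∙ E, rep, Y
    (let′ (call negᶠ (v5 ∷ []))
      (case v1 nil                                 -- U₀, U′, N, U, E, U∞, U ∙ E, rep, Y
        (case (call findᶠ (v0 ∷ v2 ∷ [])) (call pairScanᶠ (v3 ∷ v4 ∷ v3 ∷ v8 ∷ v2 ∷ [])) (v0 ∙ v1)))))
body violationᶠ =                                  -- rep, Y
  case (call defectᶠ (v0 ∷ v1 ∷ []))
    (case v0 nil (call findᶠ (v0 ∷ v3 ∷ [])))
    (v0 ∙ v1)
body flipᶠ =                                       -- X, p
  case v1 (case v0 nil (case v0 (nil ∙ nil) nil ∙ v1))
    (case v2 nil (v0 ∙ call flipᶠ (v1 ∷ v3 ∷ [])))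
body setᶠ =                                        -- X, p
  case v1 (case v0 nil ((nil ∙ nil) ∙ v1))
    (case v2 nil (v0 ∙ call setᶠ (v1 ∷ v3 ∷ [])))
body branchᶠ =                                     -- Y, ps, acc
  case v1 v2 (call flipᶠ (v2 ∷ v0 ∷ []) ∙ call branchᶠ (v2 ∷ v1 ∷ v4 ∷ []))
-- The context is nil ∙ rep or (nil ∙ d) ∙ reps, so that both levels of the search
-- share the functions below.
body oracleᶠ =                                     -- ctx, Y
  case v0 nil (case v0 (call violationᶠ (v1 ∷ v3 ∷ [])) (call repairsᶠ (v1 ∷ v3 ∷ v5 ∷ [])))
body stepᶠ =                                       -- ctx, Ys
  case v1 nil (v0 ∙ call branchᶠ (v0 ∷ call oracleᶠ (v2 ∷ v0 ∷ []) ∷ call stepᶠ (v2 ∷ v1 ∷ []) ∷ []))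
body spreadᶠ =                                     -- s, ctx, Ys
  case v0 v2 (call spreadᶠ (v1 ∷ v3 ∷ call stepᶠ (v3 ∷ v4 ∷ []) ∷ []))
body selectᶠ =                                     -- ctx, Ys
  case v1 nil (case (call oracleᶠ (v2 ∷ v0 ∷ [])) (nil ∙ v0) (call selectᶠ (v4 ∷ v3 ∷ [])))
body appendᶠ =
  case v0 v1 (v0 ∙ call appendᶠ (v1 ∷ v3 ∷ []))
body collectᶠ =                                    -- ctx, Ys
  case v1 nil (call appendᶠ (call oracleᶠ (v2 ∷ v0 ∷ []) ∷ call collectᶠ (v2 ∷ v1 ∷ []) ∷ []))
body repairᶠ =                                     -- d, rep, X
  let′ (call spreadᶠ (v0 ∷ (nil ∙ v1) ∷ (v2 ∙ nil) ∷ []))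
    (case (call selectᶠ ((nil ∙ v2) ∷ v0 ∷ [])) (call collectᶠ ((nil ∙ v2) ∷ v0 ∷ [])) nil)
body repairsᶠ =                                    -- d, reps, X
  case v1 nil (case (call repairᶠ (v2 ∷ v0 ∷ v4 ∷ [])) (call repairsᶠ (v2 ∷ v1 ∷ v4 ∷ [])) (v0 ∙ v1))
body mapSucᶠ =
  case v0 nil ((nil ∙ v0) ∙ call mapSucᶠ (v1 ∷ []))
body positionsᶠ =
  case v0 nil (nil ∙ call mapSucᶠ (call positionsᶠ (v1 ∷ []) ∷ []))
body closeᶠ =                                      -- s, rep, Y
  case v0 v2 (let′ (call closeᶠ (v1 ∷ v3 ∷ v4 ∷ []))
    (case (call defectᶠ (v4 ∷ v0 ∷ [])) v0 (call flipᶠ (v2 ∷ v0 ∷ []))))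
body tryAddᶠ =                                     -- rep, Y, F, acc
  -- The encoding of `Y` doubles as the round counter, having one cell per element of V.
  case (call findᶠ (call closeᶠ (v1 ∷ v0 ∷ v1 ∷ []) ∷ v2 ∷ [])) ((v1 ∙ v2) ∙ v3) v5
body expandᶠ =                                     -- p, rep, ss
  case v2 nil (case v0 nil                         -- Y, F, s, ss′, p, rep, ss
    (call tryAddᶠ (v5 ∷ call setᶠ (v0 ∷ v4 ∷ []) ∷ v1 ∷
      call tryAddᶠ (v5 ∷ v0 ∷ call setᶠ (v1 ∷ v4 ∷ []) ∷ call expandᶠ (v4 ∷ v5 ∷ v3 ∷ []) ∷ []) ∷ [])))
body enumᶠ =                                       -- ps, rep
  case v0 (case v1 nil (case v1 nil (case v0 nil   -- U₀, U′, U, E, U∞, U ∙ E, ps, rep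
    ((v0 ∙ v4) ∙ nil))))
    (call expandᶠ (v0 ∷ v3 ∷ call enumᶠ (v1 ∷ v3 ∷ []) ∷ []))
body firstsᶠ =
  case v0 nil (case v0 nil (v0 ∙ call firstsᶠ (v3 ∷ [])))
body doubleᶠ =
  case v0 nil (nil ∙ nil ∙ call doubleᶠ (v1 ∷ []))
body toUnaryᶠ =
  case v0 nil (let′ (call toUnaryᶠ (v1 ∷ []))
    (case v1 (call doubleᶠ ((nil ∙ v0) ∷ [])) (nil ∙ call doubleᶠ (v2 ∷ []))))
body pow2ᶠ =
  case v0 (nil ∙ nil) (call doubleᶠ (call pow2ᶠ (v1 ∷ []) ∷ []))
body incᶠ =
  case v0 ((nil ∙ nil) ∙ nil) (case v0 ((nil ∙ nil) ∙ call incᶠ (v1 ∷ [])) (nil ∙ v3))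
body toBinaryᶠ =
  case v0 nil (call incᶠ (call toBinaryᶠ (v1 ∷ []) ∷ []))

program : Expr arity 1 → Program
program main = record { p = 29 ; arity = arity ; body = body ; main = main }

-- Encodings of intermediate data.

unary : ℕ → Tree
unary zero    = nil
unary (suc x) = nil ∙ unary x

encodePosition : ∀ {m} → Fin m → Tree
encodePosition zero    = nil
encodePosition (suc p) = nil ∙ encodePosition p

encodePositions : ∀ {m} → List (Fin m) → Tree
encodePositions ps = encodeList (map encodePosition ps)

encodeFamily : ∀ {m} → List (Subset m) → Tree
encodeFamily Ys = encodeList (map encodeSubset Ys)

encodeState : ∀ {m} → Subset m × Subset m → Tree
encodeState (Y , F) = encodeSubset Y ∙ encodeSubset F

encodeStates : ∀ {m} → List (Subset m × Subset m) → Tree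
encodeStates ss = encodeList (map encodeState ss)

encodeReps : ∀ {m k} → (Fin k → RepData m) → Tree
encodeReps R = encodeList (List.tabulate (encodeRep ∘ R))

-- Running times

infixl 6 _⊕_
-- `nothing` rather than 0 marks the absence of a symbolic cost: it disappears by computation on
-- either side, so the symbolic cost of a recursive call comes through unchanged.
_⊕_ : Maybe ℕ → Maybe ℕ → Maybe ℕ
nothing ⊕ b       = b
just a  ⊕ nothing = just a
just a  ⊕ just b  = just (a + b)

cost : ℕ → Maybe ℕ → ℕ
cost c a = c + maybe′ id 0 a

cost-+ : ∀ c c′ a a′ → cost (c + c′) (a ⊕ a′) ≡ cost c a + cost c′ a′
cost-+ c c′ nothing  a′       = trans (+-assoc c c′ _) (cong (_+ cost c′ a′) (sym (+-identityʳ c)))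
cost-+ c c′ (just a) nothing  = shuffle c c′ a
  where
  shuffle : ∀ c c′ a → c + c′ + a ≡ c + a + (c′ + 0)
  shuffle = solve-∀
cost-+ c c′ (just a) (just b) = interchange +-commutativeSemigroup c c′ a b

-- The two main expressions and the cost functions.

mainExpr : Expr arity 1
mainExpr =
  case v0 nil (case v1 nil (let′ (call toUnaryᶠ (v2 ∷ []))   -- d, R₀, R′, bin, reps, input
    (case v1 nil                                             -- U∞, U ∙ E, d, R₀, R′, bin, reps, input
      (let′ ((nil ∙ v2) ∙ v6)
        -- `positionsᶠ` receives `U∞` only for its length, the size of V.
        (call selectᶠ (v0 ∷ call spreadᶠ (v3 ∷ v0 ∷ call firstsᶠ (call enumᶠ (call positionsᶠ (v1 ∷ []) ∷ v4 ∷ []) ∷ []) ∷ []) ∷ []))))))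

-- The running time needs only 2 ^ O(d²). The double exponential dominates this and is computed by
-- doublings alone.
g : ℕ → ℕ
g d = 2 ^ (2 ^ (5 + 2 * d))

gExpr : Expr arity 1
gExpr = call toBinaryᶠ (call pow2ᶠ (call pow2ᶠ
  ((nil ∙ nil ∙ nil ∙ nil ∙ nil ∙ call doubleᶠ (call toUnaryᶠ (v0 ∷ []) ∷ [])) ∷ []) ∷ []) ∷ [])

-- In units of `n ^ 3`: `suc d` shares for spreading and one each for selecting and collecting. A
-- set costs 700 in the first and 680 in the others; 800 leaves room for the additive constant.
repairCost : ℕ → ℕ
repairCost d = (3 + d) * (suc (3 ^ d) * 800)

repairCost-bound : ∀ d {l} → l ≤ 3 ^ d * 1 →
  40 + (suc d * (suc (3 ^ d * 1) * 700) + (suc l * 680 + suc l * 680)) ≤ repairCost d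
repairCost-bound d {l} l≤ = begin
  40 + (suc d * (q * 700) + (suc l * 680 + suc l * 680))
    ≤⟨ +-monoʳ-≤ 40 (+-monoʳ-≤ (suc d * (q * 700)) (+-mono-≤ (*-monoˡ-≤ 680 (s≤s l≤)) (*-monoˡ-≤ 680 (s≤s l≤)))) ⟩
  40 + (suc d * (q * 700) + (q * 680 + q * 680)) ≤⟨ absorb d q (s≤s z≤n) ⟩
  (3 + d) * (q * 800)                            ≡⟨ cong (λ e → (3 + d) * (suc e * 800)) (*-identityʳ (3 ^ d)) ⟩
  repairCost d                                   ∎
  where
  open ≤-Reasoning
  q = suc (3 ^ d * 1)
  regroup : ∀ d q → 40 * q + (suc d * (q * 700) + (q * 680 + q * 680)) + (q * 200 + suc d * (q * 100)) ≡ (3 + d) * (q * 800)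
  regroup = solve-∀
  absorb : ∀ d q → 1 ≤ q → 40 + (suc d * (q * 700) + (q * 680 + q * 680)) ≤ (3 + d) * (q * 800)
  absorb d q 1≤q = ≤-trans (+-monoˡ-≤ (suc d * (q * 700) + (q * 680 + q * 680)) (*-monoʳ-≤ 40 1≤q))
    (≤-trans (m≤m+n _ (q * 200 + suc d * (q * 100))) (≤-reflexive (regroup d q)))

enumCost-step : ∀ {l N} r → l ≤ N → 100 + (r + suc l * 1100) ≤ suc N * 1200 + r
enumCost-step {N = N} r l≤N =
  ≤-trans (+-monoʳ-≤ 100 (+-monoʳ-≤ r (*-monoˡ-≤ 1100 (s≤s l≤N)))) (absorb (suc N) (s≤s z≤n))
  where
  regroup : ∀ j r → 100 * j + (r + j * 1100) ≡ j * 1200 + r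
  regroup = solve-∀
  absorb : ∀ j → 1 ≤ j → 100 + (r + j * 1100) ≤ j * 1200 + r
  absorb j 1≤j = ≤-trans (+-monoˡ-≤ (r + j * 1100) (*-monoʳ-≤ 100 1≤j)) (≤-reflexive (regroup j r))

-- This is `perSet` for the outer search, whose oracle costs `60 + repairCost d` and lists at most
-- `3 ^ d * 2` positions.
candidateCost : ℕ → ℕ
candidateCost d = 60 + ((60 + repairCost d) + suc (3 ^ d * 2) * 40)

-- Opaque, lest conversion checking compare its numerals in unary.
opaque
  mainCost : (d N s z : ℕ) → ℕ
  mainCost d N s z = suc d * 60 + (suc N * 1200 + suc N * 20
    + suc d * (suc (suc (3 ^ d * 2) ^ d * s) * (20 + candidateCost d)) + suc z * candidateCost d)

  mainCost-def : ∀ d N s z → mainCost d N s z ≡ suc d * 60 + (suc N * 1200 + suc N * 20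
    + suc d * (suc (suc (3 ^ d * 2) ^ d * s) * (20 + candidateCost d)) + suc z * candidateCost d)
  mainCost-def d N s z = refl

-- Evaluation rules that carry cost bounds.

module TimedRules (main : Expr arity 1) (n : ℕ) .{{n≢0 : NonZero n}} where

  P : Program
  P = program main

  infix 4 _⊢_⇓_[_,_,_] _⊢_⇓*_[_,_,_] _≤[_,_,_]

  -- The cost is measured in multiples of n ^ x.  Its literal part c is kept
  -- apart from its symbolic part a, so that it normalises to a numeral.
  record _≤[_,_,_] (t c : ℕ) (a : Maybe ℕ) (x : ℕ) : Set where
    constructor within
    field get : t ≤ cost c a * n ^ x

  record _⊢_⇓_[_,_,_] {l} (ρ : Vec Tree l) (e : Expr arity l) (v : Tree) (c : ℕ) (a : Maybe ℕ) (x : ℕ) : Set where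
    constructor timed
    field
      {time} : ℕ
      eval   : Defs._⊢_⇓_⟨_⟩ P ρ e v time
      bound  : time ≤[ c , a , x ]

  record _⊢_⇓*_[_,_,_] {l k} (ρ : Vec Tree l) (es : Vec (Expr arity l) k) (vs : Vec Tree k) (c : ℕ) (a : Maybe ℕ) (x : ℕ) : Set where
    constructor timed
    field
      {time} : ℕ
      eval   : Defs._⊢_⇓*_⟨_⟩ P ρ es vs time
      bound  : time ≤[ c , a , x ]

  private variable
    l x : ℕ
    ρ : Vec Tree l

  1≤n^ : ∀ x → 1 ≤ n ^ x
  1≤n^ x = m^n>0 n x

  plus′ : ∀ {t t′ c c′ a a′} → t ≤[ c , a , x ] → t′ ≤[ c′ , a′ , x ] → t + t′ ≤[ c + c′ , a ⊕ a′ , x ]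
  plus′ {x} {t} {t′} {c} {c′} {a} {a′} (within h) (within h′) = within (begin
    t + t′                                      ≤⟨ +-mono-≤ h h′ ⟩
    cost c a * n ^ x + cost c′ a′ * n ^ x       ≡⟨ *-distribʳ-+ (n ^ x) (cost c a) _ ⟨
    (cost c a + cost c′ a′) * n ^ x             ≡⟨ cong (_* n ^ x) (cost-+ c c′ a a′) ⟨
    cost (c + c′) (a ⊕ a′) * n ^ x              ∎)
    where open ≤-Reasoning

  plus : ∀ {t t′ c c′ a a′} → t ≤[ c , a , x ] → t′ ≤[ c′ , a′ , x ] → suc (t + t′) ≤[ suc (c + c′) , a ⊕ a′ , x ]
  plus {x} h h′ = within (+-mono-≤ (1≤n^ x) (_≤[_,_,_].get (plus′ h h′)))

  unit : 1 ≤[ 1 , nothing , x ]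
  unit {x} = within (≤-trans (1≤n^ x) (m≤m+n _ 0))

  varᵗ : ∀ {i} → ρ ⊢ var i ⇓ lookup ρ i [ 1 , nothing , x ]
  varᵗ = timed (⇓-var _) unit

  nilᵗ : ρ ⊢ nil ⇓ nil [ 1 , nothing , x ]
  nilᵗ = timed ⇓-nil unit

  infixr 5 _∙ᵗ_ _∷ᵗ_
  _∙ᵗ_ : ∀ {e e′ v v′ c c′ a a′} → ρ ⊢ e ⇓ v [ c , a , x ] → ρ ⊢ e′ ⇓ v′ [ c′ , a′ , x ] →
         ρ ⊢ e ∙ e′ ⇓ v ∙ v′ [ suc (c + c′) , a ⊕ a′ , x ]
  _∙ᵗ_ (timed d h) (timed d′ h′) = timed (⇓-∙ d d′) (plus h h′)

  case-nilᵗ : ∀ {e e₁ e₂ v c c′ a a′} → ρ ⊢ e ⇓ nil [ c , a , x ] → ρ ⊢ e₁ ⇓ v [ c′ , a′ , x ] →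
              ρ ⊢ case e e₁ e₂ ⇓ v [ suc (c + c′) , a ⊕ a′ , x ]
  case-nilᵗ (timed d h) (timed d′ h′) = timed (⇓-case-nil d d′) (plus h h′)

  case-∙ᵗ : ∀ {e e₁ e₂ u w v c c′ a a′} → ρ ⊢ e ⇓ u ∙ w [ c , a , x ] → u ∷ w ∷ ρ ⊢ e₂ ⇓ v [ c′ , a′ , x ] →
            ρ ⊢ case e e₁ e₂ ⇓ v [ suc (c + c′) , a ⊕ a′ , x ]
  case-∙ᵗ (timed d h) (timed d′ h′) = timed (⇓-case-∙ d d′) (plus h h′)

  letᵗ : ∀ {e e′ u v c c′ a a′} → ρ ⊢ e ⇓ u [ c , a , x ] → u ∷ ρ ⊢ e′ ⇓ v [ c′ , a′ , x ] →
         ρ ⊢ let′ e e′ ⇓ v [ suc (c + c′) , a ⊕ a′ , x ]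
  letᵗ (timed d h) (timed d′ h′) = timed (⇓-let d d′) (plus h h′)

  callᵗ : ∀ {h es us v c c′ a a′} → ρ ⊢ es ⇓* us [ c , a , x ] → us ⊢ body h ⇓ v [ c′ , a′ , x ] →
          ρ ⊢ call h es ⇓ v [ suc (c + c′) , a ⊕ a′ , x ]
  callᵗ (timed d h) (timed d′ h′) = timed (⇓-call d d′) (plus h h′)

  []ᵗ : ρ ⊢ [] ⇓* [] [ 0 , nothing , x ]
  []ᵗ = timed [] (within z≤n)

  _∷ᵗ_ : ∀ {k e v c c′ a a′} {es : Vec (Expr arity _) k} {vs} →
         ρ ⊢ e ⇓ v [ c , a , x ] → ρ ⊢ es ⇓* vs [ c′ , a′ , x ] →
         ρ ⊢ e ∷ es ⇓* v ∷ vs [ c + c′ , a ⊕ a′ , x ]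
  _∷ᵗ_ (timed d h) (timed d′ h′) = timed (d ∷ d′) (plus′ h h′)

  private variable
    e : Expr arity l
    v : Tree
    c k : ℕ
    a b : Maybe ℕ

  weaken : ρ ⊢ e ⇓ v [ c , a , x ] → cost c a ≤ cost k b → ρ ⊢ e ⇓ v [ k , b , x ]
  weaken {x = x} (timed d (within h)) le = timed d (within (≤-trans h (*-monoˡ-≤ (n ^ x) le)))

  -- Rounding up to one numeral gives all branches of a `case` the same cost; the comparison of
  -- numerals is settled by computation.
  pad : ∀ k {_ : T (c ≤ᵇ k)} → ρ ⊢ e ⇓ v [ c , a , x ] → ρ ⊢ e ⇓ v [ k , a , x ]
  pad {c = c} {a = a} k {c≤k} d = weaken d (+-monoˡ-≤ _ (≤ᵇ⇒≤ c k c≤k))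

  lift : ∀ {y} → x ≤ y → ρ ⊢ e ⇓ v [ c , a , x ] → ρ ⊢ e ⇓ v [ c , a , y ]
  lift {c = c} {a = a} x≤y (timed d (within h)) = timed d (within (≤-trans h (*-monoʳ-≤ (cost c a) (^-monoʳ-≤ n x≤y))))

  loop-end : ∀ K i {_ : T (c ≤ᵇ K)} → ρ ⊢ e ⇓ v [ c , nothing , x ] → ρ ⊢ e ⇓ v [ 0 , just (suc i * K) , x ]
  loop-end {c = c} K i {c≤K} d = weaken d (≤-trans (≤-reflexive (+-identityʳ c)) (≤-trans (≤ᵇ⇒≤ c K c≤K) (m≤m+n K (i * K))))

  -- The literal cost of a round moves into the symbolic part, so that the induction hypothesis has
  -- the same form in every round.
  loop-step : ∀ K i {_ : T (c ≤ᵇ K)} → ρ ⊢ e ⇓ v [ c , just (i * K) , x ] → ρ ⊢ e ⇓ v [ 0 , just (suc i * K) , x ]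
  loop-step {c = c} K i {c≤K} d = weaken d (+-monoˡ-≤ (i * K) (≤ᵇ⇒≤ c K c≤K))

  -- A loop over input data has at most `n` rounds and is traded for one more power of `n`.
  scale : ∀ {i K} → i ≤ n → ρ ⊢ e ⇓ v [ 0 , just (i * K) , x ] → ρ ⊢ e ⇓ v [ K , nothing , suc x ]
  scale {x = x} {i = i} {K} i≤n (timed d (within h)) = timed d (within (begin
    _                ≤⟨ h ⟩
    i * K * n ^ x    ≡⟨ cong (_* n ^ x) (*-comm i K) ⟩
    K * i * n ^ x    ≡⟨ *-assoc K i _ ⟩
    K * (i * n ^ x)  ≤⟨ *-monoʳ-≤ K (*-monoˡ-≤ (n ^ x) i≤n) ⟩
    K * (n * n ^ x)  ≡⟨ cong (_* (n * n ^ x)) (+-identityʳ K) ⟨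
    (K + 0) * (n * n ^ x) ∎))
    where open ≤-Reasoning

-- Evaluation of the program, function by function.

module Evaluation (main : Expr arity 1) (n : ℕ) .{{n≢0 : NonZero n}} where
  open TimedRules main n public

  -- The helpers `next` and `choose` take intermediate results as plain arguments, so that splitting
  -- on them selects the branch of the `case`. The later evaluations use the same device.
  find-loop : ∀ {m} (A B : Subset m) →
    encodeSubset A ∷ encodeSubset B ∷ [] ⊢ body findᶠ
      ⇓ encodePositions (fromMaybe (find A B)) [ 0 , just (suc m * 40) , 0 ]
  find-loop []              []              = loop-end 40 0 (case-nilᵗ varᵗ nilᵗ)
  find-loop {suc m} (s ∷ A) (t ∷ B) = loop-step 40 (suc m)
    (case-∙ᵗ varᵗ (case-∙ᵗ varᵗ (letᵗ (next (find A B) (find-loop A B)) (choose s t))))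
    where
    ρ : Vec Tree 6
    ρ = encodeBool t ∷ encodeSubset B ∷ encodeBool s ∷ encodeSubset A ∷ encodeSubset (s ∷ A) ∷ encodeSubset (t ∷ B) ∷ []
    next : ∀ r {i} → encodeSubset A ∷ encodeSubset B ∷ [] ⊢ body findᶠ ⇓ encodePositions (fromMaybe r) [ 0 , just i , 0 ] →
      ρ ⊢ case (call findᶠ (v3 ∷ v1 ∷ [])) nil ((nil ∙ v0) ∙ nil)
        ⇓ encodePositions (fromMaybe (Maybe.map suc r)) [ 20 , just i , 0 ]
    next nothing  ih = pad 20 (case-nilᵗ (callᵗ (varᵗ ∷ᵗ varᵗ ∷ᵗ []ᵗ) ih) nilᵗ)
    next (just p) ih = pad 20 (case-∙ᵗ (callᵗ (varᵗ ∷ᵗ varᵗ ∷ᵗ []ᵗ) ih) ((nilᵗ ∙ᵗ varᵗ) ∙ᵗ nilᵗ))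
    choose : ∀ s′ t′ {r C D} →
      (encodePositions (fromMaybe r) ∷ encodeBool t′ ∷ C ∷ encodeBool s′ ∷ D) ⊢ case v3 v0 (case v3 v2 (nil ∙ nil))
        ⇓ encodePositions (fromMaybe (if s′ ∧ t′ then just (zero {m}) else r)) [ 10 , nothing , 0 ]
    choose false t′    = pad 10 (case-nilᵗ varᵗ varᵗ)
    choose true  false = pad 10 (case-∙ᵗ varᵗ (case-nilᵗ varᵗ varᵗ))
    choose true  true  = pad 10 (case-∙ᵗ varᵗ (case-∙ᵗ varᵗ (nilᵗ ∙ᵗ nilᵗ)))

  neg-loop : ∀ {m} (A : Subset m) →
    encodeSubset A ∷ [] ⊢ body negᶠ ⇓ encodeSubset (∁ A) [ 0 , just (suc m * 20) , 0 ]
  neg-loop []                  = loop-end 20 0 (case-nilᵗ varᵗ nilᵗ)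
  neg-loop {suc m} (false ∷ A) = loop-step 20 (suc m)
    (case-∙ᵗ varᵗ (case-nilᵗ varᵗ (nilᵗ ∙ᵗ nilᵗ) ∙ᵗ callᵗ (varᵗ ∷ᵗ []ᵗ) (neg-loop A)))
  neg-loop {suc m} (true ∷ A)  = loop-step 20 (suc m)
    (case-∙ᵗ varᵗ (case-∙ᵗ varᵗ nilᵗ ∙ᵗ callᵗ (varᵗ ∷ᵗ []ᵗ) (neg-loop A)))

  flip-loop : ∀ {m} (X : Subset m) p →
    encodeSubset X ∷ encodePosition p ∷ [] ⊢ body flipᶠ ⇓ encodeSubset (flip X p) [ 0 , just (suc m * 20) , 0 ]
  flip-loop {suc m} (false ∷ X) zero = loop-end 20 (suc m)
    (case-nilᵗ varᵗ (case-∙ᵗ varᵗ (case-nilᵗ varᵗ (nilᵗ ∙ᵗ nilᵗ) ∙ᵗ varᵗ)))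
  flip-loop {suc m} (true ∷ X)  zero = loop-end 20 (suc m)
    (case-nilᵗ varᵗ (case-∙ᵗ varᵗ (case-∙ᵗ varᵗ nilᵗ ∙ᵗ varᵗ)))
  flip-loop {suc m} (x ∷ X) (suc p) = loop-step 20 (suc m)
    (case-∙ᵗ varᵗ (case-∙ᵗ varᵗ (varᵗ ∙ᵗ callᵗ (varᵗ ∷ᵗ varᵗ ∷ᵗ []ᵗ) (flip-loop X p))))

  set-loop : ∀ {m} (X : Subset m) p →
    encodeSubset X ∷ encodePosition p ∷ [] ⊢ body setᶠ ⇓ encodeSubset (set X p) [ 0 , just (suc m * 20) , 0 ]
  set-loop {suc m} (x ∷ X) zero = loop-end 20 (suc m)
    (case-nilᵗ varᵗ (case-∙ᵗ varᵗ ((nilᵗ ∙ᵗ nilᵗ) ∙ᵗ varᵗ)))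
  set-loop {suc m} (x ∷ X) (suc p) = loop-step 20 (suc m)
    (case-∙ᵗ varᵗ (case-∙ᵗ varᵗ (varᵗ ∙ᵗ callᵗ (varᵗ ∷ᵗ varᵗ ∷ᵗ []ᵗ) (set-loop X p))))

  append-loop : ∀ {m} (ps qs : List (Fin m)) →
    encodePositions ps ∷ encodePositions qs ∷ [] ⊢ body appendᶠ
      ⇓ encodePositions (ps ++ qs) [ 0 , just (suc (length ps) * 20) , 0 ]
  append-loop []       qs = loop-end 20 0 (case-nilᵗ varᵗ varᵗ)
  append-loop (p ∷ ps) qs = loop-step 20 (suc (length ps))
    (case-∙ᵗ varᵗ (varᵗ ∙ᵗ callᵗ (varᵗ ∷ᵗ varᵗ ∷ᵗ []ᵗ) (append-loop ps qs)))

  mapSuc-loop : ∀ {m} (ps : List (Fin m)) →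
    encodePositions ps ∷ [] ⊢ body mapSucᶠ ⇓ encodePositions (map suc ps) [ 0 , just (suc (length ps) * 20) , 0 ]
  mapSuc-loop []       = loop-end 20 0 (case-nilᵗ varᵗ nilᵗ)
  mapSuc-loop (p ∷ ps) = loop-step 20 (suc (length ps))
    (case-∙ᵗ varᵗ ((nilᵗ ∙ᵗ varᵗ) ∙ᵗ callᵗ (varᵗ ∷ᵗ []ᵗ) (mapSuc-loop ps)))

  positions-loop : ∀ {m} (X : Subset m) → suc m ≤ n →
    encodeSubset X ∷ [] ⊢ body positionsᶠ ⇓ encodePositions (positions m) [ 0 , just (suc m * 40) , 1 ]
  positions-loop []              _   = loop-end 40 0 (case-nilᵗ varᵗ nilᵗ)
  positions-loop {suc m} (x ∷ X) m<n = loop-step 40 (suc m)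
    (case-∙ᵗ varᵗ (nilᵗ ∙ᵗ callᵗ (callᵗ (varᵗ ∷ᵗ []ᵗ) (positions-loop X (<⇒≤ m<n)) ∷ᵗ []ᵗ)
      (scale (≤-trans (s≤s (≤-reflexive (length-positions m))) (<⇒≤ m<n)) (mapSuc-loop (positions m)))))

  find-eval : ∀ {m} → suc m ≤ n → (A B : Subset m) →
    encodeSubset A ∷ encodeSubset B ∷ [] ⊢ body findᶠ
      ⇓ encodePositions (fromMaybe (find A B)) [ 40 , nothing , 1 ]
  find-eval m<n A B = scale m<n (find-loop A B)

  rowScan-loop : ∀ {k m} → suc m ≤ n → (R : Subset k) (V : Fin k → Subset m) (N : Subset m) →
    encodeSubset R ∷ encodeList (List.tabulate (encodeSubset ∘ V)) ∷ encodeSubset N ∷ [] ⊢ body rowScanᶠ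
      ⇓ encodePositions (fromMaybe (rowScan R V N)) [ 0 , just (suc k * 80) , 1 ]
  rowScan-loop m<n [] V N = loop-end 80 0 (case-nilᵗ varᵗ nilᵗ)
  rowScan-loop {suc k} {m} m<n (r ∷ R) V N = loop-step 80 (suc k)
    (case-∙ᵗ varᵗ (case-∙ᵗ varᵗ (letᵗ (callᵗ (varᵗ ∷ᵗ varᵗ ∷ᵗ varᵗ ∷ᵗ []ᵗ) (rowScan-loop m<n R (V ∘ suc) N))
      (choose r (find (V zero) N) (find-eval m<n (V zero) N)))))
    where
    choose : ∀ {rest : Maybe (Fin m)} {V′ R′ Rs Vs} r q →
      encodeSubset (V zero) ∷ encodeSubset N ∷ [] ⊢ body findᶠ ⇓ encodePositions (fromMaybe q) [ 40 , nothing , 1 ] →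
      encodePositions (fromMaybe rest) ∷ encodeSubset (V zero) ∷ V′ ∷ encodeBool r ∷ R′ ∷ Rs ∷ Vs ∷ encodeSubset N ∷ []
        ⊢ case v3 v0 (case (call findᶠ (v3 ∷ v9 ∷ [])) v2 (v0 ∙ v1))
        ⇓ encodePositions (fromMaybe ((if r then q else nothing) <∣> rest)) [ 60 , nothing , 1 ]
    choose false q        d = pad 60 (case-nilᵗ varᵗ varᵗ)
    choose true  nothing  d = pad 60 (case-∙ᵗ varᵗ (case-nilᵗ (callᵗ (varᵗ ∷ᵗ varᵗ ∷ᵗ []ᵗ) d) varᵗ))
    choose true  (just q) d = pad 60 (case-∙ᵗ varᵗ (case-∙ᵗ (callᵗ (varᵗ ∷ᵗ varᵗ ∷ᵗ []ᵗ) d) (varᵗ ∙ᵗ varᵗ)))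

  pairScan-loop : ∀ {l k m} → suc m ≤ n → suc k ≤ n →
    (U : Fin l → Subset m) (E : Fin l → Subset k) (V : Fin k → Subset m) (Y N : Subset m) →
    encodeList (List.tabulate (encodeSubset ∘ U)) ∷ encodeList (List.tabulate (encodeSubset ∘ E))
      ∷ encodeList (List.tabulate (encodeSubset ∘ V)) ∷ encodeSubset Y ∷ encodeSubset N ∷ [] ⊢ body pairScanᶠ
      ⇓ encodePositions (pairScan U E V Y N) [ 0 , just (suc l * 250) , 2 ]
  pairScan-loop {zero}  m<n k<n U E V Y N = loop-end 250 0 (case-nilᵗ varᵗ nilᵗ)
  pairScan-loop {suc l} {k} {m} m<n k<n U E V Y N = loop-step 250 (suc l)
    (case-∙ᵗ varᵗ (case-∙ᵗ varᵗ (letᵗ (callᵗ (varᵗ ∷ᵗ varᵗ ∷ᵗ varᵗ ∷ᵗ varᵗ ∷ᵗ varᵗ ∷ᵗ []ᵗ)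
        (pairScan-loop m<n k<n (U ∘ suc) (E ∘ suc) V Y N))
      (choose (find (U zero) Y) (find (U zero) N) (rowScan (E zero) V N)
        (lift (s≤s z≤n) (find-eval m<n (U zero) Y)) (lift (s≤s z≤n) (find-eval m<n (U zero) N))
        (scale k<n (rowScan-loop m<n (E zero) V N))))))
    where
    choose : ∀ {rest : List (Fin m)} {E′ U′ Us Es} p q r →
      encodeSubset (U zero) ∷ encodeSubset Y ∷ [] ⊢ body findᶠ ⇓ encodePositions (fromMaybe p) [ 40 , nothing , 2 ] →
      encodeSubset (U zero) ∷ encodeSubset N ∷ [] ⊢ body findᶠ ⇓ encodePositions (fromMaybe q) [ 40 , nothing , 2 ] →
      encodeSubset (E zero) ∷ encodeList (List.tabulate (encodeSubset ∘ V)) ∷ encodeSubset N ∷ [] ⊢ body rowScanᶠ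
        ⇓ encodePositions (fromMaybe r) [ 80 , nothing , 2 ] →
      encodePositions rest ∷ encodeSubset (E zero) ∷ E′ ∷ encodeSubset (U zero) ∷ U′ ∷ Us ∷ Es
        ∷ encodeList (List.tabulate (encodeSubset ∘ V)) ∷ encodeSubset Y ∷ encodeSubset N ∷ []
        ⊢ case (call findᶠ (v3 ∷ v8 ∷ [])) v0
            (case (case (call findᶠ (v5 ∷ v11 ∷ [])) (call rowScanᶠ (v3 ∷ v9 ∷ v11 ∷ [])) (v0 ∙ v1))
              v2 (v0 ∙ v2 ∙ nil))
        ⇓ encodePositions (link p (q <∣> r) orElse rest) [ 200 , nothing , 2 ]
    choose nothing _ _ dp dq dr = pad 200 (case-nilᵗ (callᵗ (varᵗ ∷ᵗ varᵗ ∷ᵗ []ᵗ) dp) varᵗ)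
    choose (just p) (just q) _ dp dq dr = pad 200 (case-∙ᵗ (callᵗ (varᵗ ∷ᵗ varᵗ ∷ᵗ []ᵗ) dp)
      (case-∙ᵗ (case-∙ᵗ (callᵗ (varᵗ ∷ᵗ varᵗ ∷ᵗ []ᵗ) dq) (varᵗ ∙ᵗ varᵗ)) (varᵗ ∙ᵗ varᵗ ∙ᵗ nilᵗ)))
    choose (just p) nothing (just q) dp dq dr = pad 200 (case-∙ᵗ (callᵗ (varᵗ ∷ᵗ varᵗ ∷ᵗ []ᵗ) dp)
      (case-∙ᵗ (case-nilᵗ (callᵗ (varᵗ ∷ᵗ varᵗ ∷ᵗ []ᵗ) dq) (callᵗ (varᵗ ∷ᵗ varᵗ ∷ᵗ varᵗ ∷ᵗ []ᵗ) dr)) (varᵗ ∙ᵗ varᵗ ∙ᵗ nilᵗ)))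
    choose (just p) nothing nothing dp dq dr = pad 200 (case-∙ᵗ (callᵗ (varᵗ ∷ᵗ varᵗ ∷ᵗ []ᵗ) dp)
      (case-nilᵗ (case-nilᵗ (callᵗ (varᵗ ∷ᵗ varᵗ ∷ᵗ []ᵗ) dq) (callᵗ (varᵗ ∷ᵗ varᵗ ∷ᵗ varᵗ ∷ᵗ []ᵗ) dr)) varᵗ))

  symbolic : ∀ {l} {ρ : Vec Tree l} {e v c x} → ρ ⊢ e ⇓ v [ c , nothing , x ] → ρ ⊢ e ⇓ v [ 0 , just c , x ]
  symbolic {c = c} d = weaken d (≤-reflexive (+-identityʳ c))

  module _ {m} (R : RepData m) (m<n : suc m ≤ n) (b<n : suc (suc (RepData.b R)) ≤ n) where
    open RepData R
    open Rep R
    open Enumeration R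

    defect-eval : ∀ Y → encodeRep R ∷ encodeSubset Y ∷ [] ⊢ body defectᶠ
      ⇓ encodePositions (defect Y) [ 350 , nothing , 3 ]
    defect-eval Y = pad 350 (case-∙ᵗ varᵗ (case-∙ᵗ varᵗ (letᵗ (callᵗ (varᵗ ∷ᵗ []ᵗ) (lift (s≤s z≤n) (scale m<n (neg-loop Y))))
      (case-∙ᵗ varᵗ (choose (find (U zero) (∁ Y)) (pairScan U E U Y (∁ Y))
        (lift (s≤s z≤n) (find-eval m<n (U zero) (∁ Y))) (scale b<n (pairScan-loop m<n b<n U E U Y (∁ Y))))))))
      where
      Us Es : Tree
      Us = encodeList (List.tabulate (encodeSubset ∘ U))
      Es = encodeList (List.tabulate (encodeSubset ∘ E))
      choose : ∀ {U′ T₁ T₂ T₃} q (xs : List (Fin m)) →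
        encodeSubset (U zero) ∷ encodeSubset (∁ Y) ∷ [] ⊢ body findᶠ ⇓ encodePositions (fromMaybe q) [ 40 , nothing , 3 ] →
        Us ∷ Es ∷ Us ∷ encodeSubset Y ∷ encodeSubset (∁ Y) ∷ [] ⊢ body pairScanᶠ ⇓ encodePositions xs [ 250 , nothing , 3 ] →
        encodeSubset (U zero) ∷ U′ ∷ encodeSubset (∁ Y) ∷ Us ∷ Es ∷ T₁ ∷ T₂ ∷ T₃ ∷ encodeSubset Y ∷ []
          ⊢ case (call findᶠ (v0 ∷ v2 ∷ [])) (call pairScanᶠ (v3 ∷ v4 ∷ v3 ∷ v8 ∷ v2 ∷ [])) (v0 ∙ v1)
          ⇓ encodePositions (fromMaybe q orElse xs) [ 310 , nothing , 3 ]
      choose (just q) xs d d′ = pad 310 (case-∙ᵗ (callᵗ (varᵗ ∷ᵗ varᵗ ∷ᵗ []ᵗ) d) (varᵗ ∙ᵗ varᵗ))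
      choose nothing  xs d d′ = pad 310 (case-nilᵗ (callᵗ (varᵗ ∷ᵗ varᵗ ∷ᵗ []ᵗ) d)
        (callᵗ (varᵗ ∷ᵗ varᵗ ∷ᵗ varᵗ ∷ᵗ varᵗ ∷ᵗ varᵗ ∷ᵗ []ᵗ) d′))

    violation-eval : ∀ Y → encodeRep R ∷ encodeSubset Y ∷ [] ⊢ body violationᶠ
      ⇓ encodePositions (violation Y) [ 450 , nothing , 3 ]
    violation-eval Y = choose (defect Y) (fromMaybe (find U∞ Y)) (defect-eval Y) (lift (s≤s z≤n) (find-eval m<n U∞ Y))
      where
      choose : ∀ (xs ys : List (Fin m)) →
        encodeRep R ∷ encodeSubset Y ∷ [] ⊢ body defectᶠ ⇓ encodePositions xs [ 350 , nothing , 3 ] →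
        encodeSubset U∞ ∷ encodeSubset Y ∷ [] ⊢ body findᶠ ⇓ encodePositions ys [ 40 , nothing , 3 ] →
        encodeRep R ∷ encodeSubset Y ∷ [] ⊢ body violationᶠ ⇓ encodePositions (xs orElse ys) [ 450 , nothing , 3 ]
      choose (x ∷ xs) ys d d′ = pad 450 (case-∙ᵗ (callᵗ (varᵗ ∷ᵗ varᵗ ∷ᵗ []ᵗ) d) (varᵗ ∙ᵗ varᵗ))
      choose []       ys d d′ = pad 450 (case-nilᵗ (callᵗ (varᵗ ∷ᵗ varᵗ ∷ᵗ []ᵗ) d)
        (case-∙ᵗ varᵗ (callᵗ (varᵗ ∷ᵗ varᵗ ∷ᵗ []ᵗ) d′)))

    close-loop : ∀ {s} (C : Subset s) Y → encodeSubset C ∷ encodeRep R ∷ encodeSubset Y ∷ [] ⊢ body closeᶠ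
      ⇓ encodeSubset (close s Y) [ 0 , just (suc s * 400) , 3 ]
    close-loop []      Y = loop-end 400 0 (case-nilᵗ varᵗ varᵗ)
    close-loop {suc s} (t ∷ C) Y = loop-step 400 (suc s)
      (case-∙ᵗ varᵗ (letᵗ (callᵗ (varᵗ ∷ᵗ varᵗ ∷ᵗ varᵗ ∷ᵗ []ᵗ) (close-loop C Y))
        (choose (close s Y) (defect (close s Y)) refl (defect-eval (close s Y)))))
      where
      choose : ∀ Z (xs : List (Fin m)) → defect Z ≡ xs → ∀ {T₁ T₂ T₃ T₄} →
        encodeRep R ∷ encodeSubset Z ∷ [] ⊢ body defectᶠ ⇓ encodePositions xs [ 350 , nothing , 3 ] →
        encodeSubset Z ∷ T₁ ∷ T₂ ∷ T₃ ∷ encodeRep R ∷ T₄ ∷ [] ⊢ case (call defectᶠ (v4 ∷ v0 ∷ [])) v0 (call flipᶠ (v2 ∷ v0 ∷ []))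
          ⇓ encodeSubset (grow Z) [ 380 , nothing , 3 ]
      choose Z xs eq d with defect Z
      choose Z [] refl d | .[] = pad 380 (case-nilᵗ (callᵗ (varᵗ ∷ᵗ varᵗ ∷ᵗ []ᵗ) d) varᵗ)
      choose Z (q ∷ xs) refl d | .(q ∷ xs) = pad 380 (case-∙ᵗ (callᵗ (varᵗ ∷ᵗ varᵗ ∷ᵗ []ᵗ) d)
        (callᵗ (varᵗ ∷ᵗ varᵗ ∷ᵗ []ᵗ) (lift (s≤s z≤n) (scale m<n (flip-loop Z q)))))

    close-eval : ∀ Y → encodeSubset Y ∷ encodeRep R ∷ encodeSubset Y ∷ [] ⊢ body closeᶠ
      ⇓ encodeSubset (close m Y) [ 400 , nothing , 4 ]
    close-eval Y = scale m<n (close-loop Y Y)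

    tryAdd-eval : ∀ Y F ss →
      encodeRep R ∷ encodeSubset Y ∷ encodeSubset F ∷ encodeStates ss ∷ [] ⊢ body tryAddᶠ
        ⇓ encodeStates (tryAdd (Y , F) ss) [ 500 , nothing , 4 ]
    tryAdd-eval Y F ss = choose (find (close m Y) F) (lift (s≤s z≤n) (find-eval m<n (close m Y) F))
      where
      choose : ∀ r →
        encodeSubset (close m Y) ∷ encodeSubset F ∷ [] ⊢ body findᶠ ⇓ encodePositions (fromMaybe r) [ 40 , nothing , 4 ] →
        encodeRep R ∷ encodeSubset Y ∷ encodeSubset F ∷ encodeStates ss ∷ [] ⊢ body tryAddᶠ
          ⇓ encodeStates (maybe′ (const ss) ((Y , F) ∷ ss) r) [ 500 , nothing , 4 ]
      choose nothing  d = pad 500 (case-nilᵗ (callᵗ (callᵗ (varᵗ ∷ᵗ varᵗ ∷ᵗ varᵗ ∷ᵗ []ᵗ) (close-eval Y) ∷ᵗ varᵗ ∷ᵗ []ᵗ) d)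
        ((varᵗ ∙ᵗ varᵗ) ∙ᵗ varᵗ))
      choose (just p) d = pad 500 (case-∙ᵗ (callᵗ (callᵗ (varᵗ ∷ᵗ varᵗ ∷ᵗ varᵗ ∷ᵗ []ᵗ) (close-eval Y) ∷ᵗ varᵗ ∷ᵗ []ᵗ) d) varᵗ)

    expand-loop : ∀ p ss → encodePosition p ∷ encodeRep R ∷ encodeStates ss ∷ [] ⊢ body expandᶠ
      ⇓ encodeStates (expand p ss) [ 0 , just (suc (length ss) * 1100) , 4 ]
    expand-loop p []             = loop-end 1100 0 (case-nilᵗ varᵗ nilᵗ)
    expand-loop p ((Y , F) ∷ ss) = loop-step 1100 (suc (length ss))
      (case-∙ᵗ varᵗ (case-∙ᵗ varᵗ
        (callᵗ (varᵗ ∷ᵗ callᵗ (varᵗ ∷ᵗ varᵗ ∷ᵗ []ᵗ) (lift (s≤s z≤n) (scale m<n (set-loop Y p))) ∷ᵗ varᵗ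
            ∷ᵗ callᵗ (varᵗ ∷ᵗ varᵗ ∷ᵗ callᵗ (varᵗ ∷ᵗ varᵗ ∷ᵗ []ᵗ) (lift (s≤s z≤n) (scale m<n (set-loop F p)))
                ∷ᵗ callᵗ (varᵗ ∷ᵗ varᵗ ∷ᵗ varᵗ ∷ᵗ []ᵗ) (expand-loop p ss) ∷ᵗ []ᵗ)
              (tryAdd-eval Y (set F p) (expand p ss)) ∷ᵗ []ᵗ)
          (tryAdd-eval (set Y p) F (tryAdd (Y , set F p) (expand p ss))))))

    -- The bound is assumed for every list of positions because each intermediate list of states is
    -- expanded and has to be paid for.
    enum-loop : ∀ N → (∀ ps → length (enum ps) ≤ N) → ∀ ps →
      encodePositions ps ∷ encodeRep R ∷ [] ⊢ body enumᶠ
        ⇓ encodeStates (enum ps) [ 0 , just (suc (length ps) * (suc N * 1200)) , 4 ]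
    enum-loop N bound []       = weaken
      (pad 100 (case-nilᵗ varᵗ (case-∙ᵗ varᵗ (case-∙ᵗ varᵗ (case-∙ᵗ varᵗ ((varᵗ ∙ᵗ varᵗ) ∙ᵗ nilᵗ))))))
      (≤-trans (≤ᵇ⇒≤ 100 1200 _) (≤-trans (m≤m+n 1200 (N * 1200)) (m≤m+n (suc N * 1200) (0 * (suc N * 1200)))))
    enum-loop N bound (p ∷ ps) = weaken (pad 100
      (case-∙ᵗ varᵗ (callᵗ (varᵗ ∷ᵗ varᵗ ∷ᵗ callᵗ (varᵗ ∷ᵗ varᵗ ∷ᵗ []ᵗ) (enum-loop N bound ps) ∷ᵗ []ᵗ) (expand-loop p (enum ps)))))
      (enumCost-step (suc (length ps) * (suc N * 1200)) (bound ps))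

    firsts-loop : ∀ (ss : List State) → encodeStates ss ∷ [] ⊢ body firstsᶠ
      ⇓ encodeFamily (map proj₁ ss) [ 0 , just (suc (length ss) * 20) , 0 ]
    firsts-loop []             = loop-end 20 0 (case-nilᵗ varᵗ nilᵗ)
    firsts-loop ((Y , F) ∷ ss) = loop-step 20 (suc (length ss))
      (case-∙ᵗ varᵗ (case-∙ᵗ varᵗ (varᵗ ∙ᵗ callᵗ (varᵗ ∷ᵗ []ᵗ) (firsts-loop ss))))

  module _ {m} (m<n : suc m ≤ n) where

    branch-loop : ∀ (Y : Subset m) ps acc →
      encodeSubset Y ∷ encodePositions ps ∷ encodeFamily acc ∷ [] ⊢ body branchᶠ
        ⇓ encodeFamily (branch Y ps acc) [ 0 , just (suc (length ps) * 40) , 1 ]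
    branch-loop Y []       acc = loop-end 40 0 (case-nilᵗ varᵗ varᵗ)
    branch-loop Y (p ∷ ps) acc = loop-step 40 (suc (length ps))
      (case-∙ᵗ varᵗ (callᵗ (varᵗ ∷ᵗ varᵗ ∷ᵗ []ᵗ) (scale {K = 20} m<n (flip-loop Y p))
        ∙ᵗ callᵗ (varᵗ ∷ᵗ varᵗ ∷ᵗ varᵗ ∷ᵗ []ᵗ) (branch-loop Y ps acc)))

    module _ (ctx : Tree) (o : Subset m → List (Fin m)) (w : ℕ) (short : ∀ Y → length (o Y) ≤ w) (K x : ℕ)
      (oracle-eval : ∀ Y → ctx ∷ encodeSubset Y ∷ [] ⊢ body oracleᶠ ⇓ encodePositions (o Y) [ 0 , just K , suc x ])
      where
      open Search o
      open SearchLength o w short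

      -- One oracle call and one pass over its answer: enough for a set in `step`, `select` or
      -- `collect` alike.
      perSet : ℕ
      perSet = 60 + (K + suc w * 40)

      60≤perSet : 60 ≤ suc 0 * perSet
      60≤perSet = ≤-trans (m≤m+n 60 (K + suc w * 40)) (m≤m+n perSet (0 * perSet))

      step-loop : ∀ Ys → ctx ∷ encodeFamily Ys ∷ [] ⊢ body stepᶠ
        ⇓ encodeFamily (step Ys) [ 0 , just (suc (length Ys) * perSet) , suc x ]
      step-loop []       = weaken (pad 60 (case-nilᵗ varᵗ nilᵗ)) 60≤perSet
      step-loop (Y ∷ Ys) = weaken {c = 60} {a = just (K + rest + suc (length (o Y)) * 40)} (pad 60
        (case-∙ᵗ varᵗ (varᵗ ∙ᵗ callᵗ (varᵗ ∷ᵗ callᵗ (varᵗ ∷ᵗ varᵗ ∷ᵗ []ᵗ) (oracle-eval Y)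
            ∷ᵗ callᵗ (varᵗ ∷ᵗ varᵗ ∷ᵗ []ᵗ) (step-loop Ys) ∷ᵗ []ᵗ)
          (lift (s≤s z≤n) (branch-loop Y (o Y) (step Ys))))))
        (begin
          60 + (K + rest + suc (length (o Y)) * 40) ≤⟨ +-monoʳ-≤ 60 (+-monoʳ-≤ (K + rest) (*-monoˡ-≤ 40 (s≤s (short Y)))) ⟩
          60 + (K + rest + suc w * 40)              ≡⟨ regroup K rest (suc w * 40) ⟩
          perSet + rest                             ∎)
        where
        open ≤-Reasoning
        rest = suc (length Ys) * perSet
        regroup : ∀ k r b → 60 + (k + r + b) ≡ 60 + (k + b) + r
        regroup = solve-∀

      -- Every round is charged at the size bound for the last one, which avoids summing a geometric
      -- series.
      spread-cost : ℕ → List (Subset m) → ℕ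
      spread-cost s Ys = suc s * (suc (suc w ^ s * length Ys) * (20 + perSet))

      spread-loop : ∀ s Ys → unary s ∷ ctx ∷ encodeFamily Ys ∷ [] ⊢ body spreadᶠ
        ⇓ encodeFamily (spread s Ys) [ 0 , just (spread-cost s Ys) , suc x ]
      spread-loop zero    Ys = weaken (pad 20 (case-nilᵗ varᵗ varᵗ))
        (≤-trans (m≤m+n 20 perSet) (≤-trans (m≤m+n (20 + perSet) (1 * length Ys * (20 + perSet)))
          (m≤m+n (suc (1 * length Ys) * (20 + perSet)) (0 * (suc (1 * length Ys) * (20 + perSet))))))
      spread-loop (suc s) Ys = weaken (pad 20
        (case-∙ᵗ varᵗ (callᵗ (varᵗ ∷ᵗ varᵗ ∷ᵗ callᵗ (varᵗ ∷ᵗ varᵗ ∷ᵗ []ᵗ) (step-loop Ys) ∷ᵗ []ᵗ) (spread-loop s (step Ys)))))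
        (begin
          20 + (suc l * perSet + suc s * (suc (suc w ^ s * length (step Ys)) * c₁))
            ≤⟨ +-monoʳ-≤ 20 (+-monoʳ-≤ (suc l * perSet) (*-monoʳ-≤ (suc s) (*-monoˡ-≤ c₁ (s≤s grows)))) ⟩
          20 + (suc l * perSet + suc s * Q)      ≡⟨ +-assoc 20 (suc l * perSet) _ ⟨
          20 + suc l * perSet + suc s * Q        ≤⟨ +-monoˡ-≤ (suc s * Q) first ⟩
          Q + suc s * Q                          ∎)
        where
        open ≤-Reasoning
        l = length Ys
        c₁ = 20 + perSet
        Q = suc (suc w ^ suc s * l) * c₁
        grows : suc w ^ s * length (step Ys) ≤ suc w ^ suc s * l
        grows = ≤-trans (*-monoʳ-≤ (suc w ^ s) (step-length Ys)) (≤-reflexive (shift-power (suc w) (suc w ^ s) l))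
        first : 20 + suc l * perSet ≤ Q
        first = begin
          20 + suc l * perSet         ≤⟨ +-monoˡ-≤ (suc l * perSet) (m≤m+n 20 (l * 20)) ⟩
          suc l * 20 + suc l * perSet ≡⟨ *-distribˡ-+ (suc l) 20 perSet ⟨
          suc l * c₁                   ≤⟨ *-monoˡ-≤ c₁ (s≤s (m≤n*m l (suc w ^ suc s) {{m^n≢0 (suc w) (suc s)}})) ⟩
          Q                           ∎

      select-loop : ∀ Ys → ctx ∷ encodeFamily Ys ∷ [] ⊢ body selectᶠ
        ⇓ encodeResult (select Ys) [ 0 , just (suc (length Ys) * perSet) , suc x ]
      select-loop []       = weaken (pad 60 (case-nilᵗ varᵗ nilᵗ)) 60≤perSet
      select-loop (Y ∷ Ys) = weaken {c = 60} {a = just (K + rest)} (pad 60 (case-∙ᵗ varᵗ (choose (o Y) (oracle-eval Y))))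
        (+-monoʳ-≤ 60 (+-monoˡ-≤ rest (m≤m+n K (suc w * 40))))
        where
        rest = suc (length Ys) * perSet
        choose : ∀ ps → ctx ∷ encodeSubset Y ∷ [] ⊢ body oracleᶠ ⇓ encodePositions ps [ 0 , just K , suc x ] →
          encodeSubset Y ∷ encodeFamily Ys ∷ ctx ∷ encodeFamily (Y ∷ Ys) ∷ []
            ⊢ case (call oracleᶠ (v2 ∷ v0 ∷ [])) (nil ∙ v0) (call selectᶠ (v4 ∷ v3 ∷ []))
            ⇓ encodeResult (ifNull ps (just Y) (select Ys)) [ 50 , just (K + rest) , suc x ]
        choose []      d = weaken {c = 50} {a = just K} (pad 50 (case-nilᵗ (callᵗ (varᵗ ∷ᵗ varᵗ ∷ᵗ []ᵗ) d) (nilᵗ ∙ᵗ varᵗ)))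
          (+-monoʳ-≤ 50 (m≤m+n K rest))
        choose (_ ∷ _) d = pad 50 (case-∙ᵗ (callᵗ (varᵗ ∷ᵗ varᵗ ∷ᵗ []ᵗ) d)
          (callᵗ (varᵗ ∷ᵗ varᵗ ∷ᵗ []ᵗ) (select-loop Ys)))

      collect-loop : ∀ Ys → ctx ∷ encodeFamily Ys ∷ [] ⊢ body collectᶠ
        ⇓ encodePositions (collect Ys) [ 0 , just (suc (length Ys) * perSet) , suc x ]
      collect-loop []       = weaken (pad 60 (case-nilᵗ varᵗ nilᵗ)) 60≤perSet
      collect-loop (Y ∷ Ys) = weaken {c = 60} {a = just (K + rest + suc (length (o Y)) * 20)} (pad 60
        (case-∙ᵗ varᵗ (callᵗ (callᵗ (varᵗ ∷ᵗ varᵗ ∷ᵗ []ᵗ) (oracle-eval Y)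
            ∷ᵗ callᵗ (varᵗ ∷ᵗ varᵗ ∷ᵗ []ᵗ) (collect-loop Ys) ∷ᵗ []ᵗ)
          (lift z≤n (append-loop (o Y) (collect Ys))))))
        (begin
          60 + (K + rest + suc (length (o Y)) * 20)
            ≤⟨ +-monoʳ-≤ 60 (+-monoʳ-≤ (K + rest) (*-mono-≤ (s≤s (short Y)) (≤ᵇ⇒≤ 20 40 _))) ⟩
          60 + (K + rest + suc w * 40)              ≡⟨ regroup K rest (suc w * 40) ⟩
          perSet + rest                             ∎)
        where
        open ≤-Reasoning
        rest = suc (length Ys) * perSet
        regroup : ∀ k r b → 60 + (k + r + b) ≡ 60 + (k + b) + r
        regroup = solve-∀

  double-loop : ∀ s → unary s ∷ [] ⊢ body doubleᶠ ⇓ unary (2 * s) [ 0 , just (suc s * 20) , 0 ]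
  double-loop zero    = loop-end 20 0 (case-nilᵗ varᵗ nilᵗ)
  double-loop (suc s) = subst (λ r → unary (suc s) ∷ [] ⊢ body doubleᶠ ⇓ unary (suc r) [ 0 , just (suc (suc s) * 20) , 0 ])
    (sym (+-suc s (s + 0)))
    (loop-step 20 (suc s) (case-∙ᵗ varᵗ (nilᵗ ∙ᵗ nilᵗ ∙ᵗ callᵗ (varᵗ ∷ᵗ []ᵗ) (double-loop s))))

  -- The cost is linear in the value, possibly exponential in the length of the binary encoding. It
  -- is charged to `g d` and not to a power of `n`.
  toUnary-loop : ∀ s → encodeℕᵇ s ∷ [] ⊢ body toUnaryᶠ ⇓ unary (ℕᵇ.toℕ s) [ 0 , just (suc (ℕᵇ.toℕ s) * 60) , 0 ]
  toUnary-loop ℕᵇ.zero  = loop-end 60 0 (case-nilᵗ varᵗ nilᵗ)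
  toUnary-loop 2[1+ s ] = weaken {c = 30} {a = just (suc i * 60 + suc (suc i) * 20)}
    (pad 30 (case-∙ᵗ varᵗ (letᵗ (callᵗ (varᵗ ∷ᵗ []ᵗ) (toUnary-loop s))
      (case-nilᵗ varᵗ (callᵗ ((nilᵗ ∙ᵗ varᵗ) ∷ᵗ []ᵗ) (double-loop (suc i)))))))
    (≤-trans (m≤m+n _ (50 + i * 40)) (≤-reflexive (regroup i)))
    where
    i = ℕᵇ.toℕ s
    regroup : ∀ i → 30 + (suc i * 60 + suc (suc i) * 20) + (50 + i * 40) ≡ suc (2 * suc i) * 60
    regroup = solve-∀
  toUnary-loop 1+[2 s ] = weaken {c = 30} {a = just (suc i * 60 + suc i * 20)}
    (pad 30 (case-∙ᵗ varᵗ (letᵗ (callᵗ (varᵗ ∷ᵗ []ᵗ) (toUnary-loop s))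
      (case-∙ᵗ varᵗ (nilᵗ ∙ᵗ callᵗ (varᵗ ∷ᵗ []ᵗ) (double-loop i))))))
    (≤-trans (m≤m+n _ (10 + i * 40)) (≤-reflexive (regroup i)))
    where
    i = ℕᵇ.toℕ s
    regroup : ∀ i → 30 + (suc i * 60 + suc i * 20) + (10 + i * 40) ≡ suc (suc (2 * i)) * 60
    regroup = solve-∀

  toUnary-eval : ∀ d → encodeℕ d ∷ [] ⊢ body toUnaryᶠ ⇓ unary d [ 0 , just (suc d * 60) , 0 ]
  toUnary-eval d = subst (λ i → encodeℕ d ∷ [] ⊢ body toUnaryᶠ ⇓ unary i [ 0 , just (suc i * 60) , 0 ])
    (ℕᵇ.toℕ-fromℕ d) (toUnary-loop (ℕᵇ.fromℕ d))

  Small : ∀ {m k} → (Fin k → RepData m) → Set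
  Small R = ∀ i → suc (suc (RepData.b (R i))) ≤ n

  module _ {m} (m<n : suc m ≤ n) (d : ℕ) where

    module _ (R : RepData m) (b<n : suc (suc (RepData.b R)) ≤ n) where
      open Rep R
      open Search violation

      inner-oracle : ∀ Y → (nil ∙ encodeRep R) ∷ encodeSubset Y ∷ [] ⊢ body oracleᶠ
        ⇓ encodePositions (violation Y) [ 0 , just 500 , 3 ]
      inner-oracle Y = symbolic (pad 500 (case-∙ᵗ varᵗ (case-nilᵗ varᵗ
        (callᵗ (varᵗ ∷ᵗ varᵗ ∷ᵗ []ᵗ) (violation-eval R m<n b<n Y)))))

      repair-eval : ∀ X → unary d ∷ encodeRep R ∷ encodeSubset X ∷ [] ⊢ body repairᶠ
        ⇓ encodePositions (repair d X) [ 0 , just (repairCost d) , 3 ]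
      repair-eval X = weaken {c = 40} {a = just (suc d * (suc (3 ^ d * 1) * 700) + (suc l * 680 + suc l * 680))} (pad 40
        (letᵗ (callᵗ (varᵗ ∷ᵗ (nilᵗ ∙ᵗ varᵗ) ∷ᵗ (varᵗ ∙ᵗ nilᵗ) ∷ᵗ []ᵗ)
            (spread-loop m<n (nil ∙ encodeRep R) violation 2 violation-length 500 2 inner-oracle d (X ∷ [])))
          (choose (select zs) (select-loop m<n (nil ∙ encodeRep R) violation 2 violation-length 500 2 inner-oracle zs))))
        (repairCost-bound d (SearchLength.spread-length violation 2 violation-length d (X ∷ [])))
        where
        zs = spread d (X ∷ [])
        l = length zs
        choose : ∀ r → (nil ∙ encodeRep R) ∷ encodeFamily zs ∷ [] ⊢ body selectᶠ ⇓ encodeResult r [ 0 , just (suc l * 680) , 3 ] →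
          encodeFamily zs ∷ unary d ∷ encodeRep R ∷ encodeSubset X ∷ []
            ⊢ case (call selectᶠ ((nil ∙ v2) ∷ v0 ∷ [])) (call collectᶠ ((nil ∙ v2) ∷ v0 ∷ [])) nil
            ⇓ encodePositions (maybe′ (const []) (collect zs) r) [ 20 , just (suc l * 680 + suc l * 680) , 3 ]
        choose nothing e = pad 20 (case-nilᵗ (callᵗ ((nilᵗ ∙ᵗ varᵗ) ∷ᵗ varᵗ ∷ᵗ []ᵗ) e)
          (callᵗ ((nilᵗ ∙ᵗ varᵗ) ∷ᵗ varᵗ ∷ᵗ []ᵗ)
            (collect-loop m<n (nil ∙ encodeRep R) violation 2 violation-length 500 2 inner-oracle zs)))
        choose (just _) e = weaken {c = 20} {a = just (suc l * 680)}
          (pad 20 (case-∙ᵗ (callᵗ ((nilᵗ ∙ᵗ varᵗ) ∷ᵗ varᵗ ∷ᵗ []ᵗ) e) nilᵗ))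
          (+-monoʳ-≤ 20 (m≤m+n (suc l * 680) (suc l * 680)))

    repairs-loop : ∀ {k} (R : Fin k → RepData m) → Small R → ∀ X →
      unary d ∷ encodeReps R ∷ encodeSubset X ∷ [] ⊢ body repairsᶠ
        ⇓ encodePositions (repairs d R X) [ 0 , just (suc k * (40 + repairCost d)) , 3 ]
    repairs-loop {zero}  R small X = weaken (pad 40 (case-nilᵗ varᵗ nilᵗ))
      (≤-trans (m≤m+n 40 (repairCost d)) (m≤m+n (40 + repairCost d) (0 * (40 + repairCost d))))
    repairs-loop {suc k} R small X = weaken {c = 40} {a = just (repairCost d + rest)}
      (pad 40 (case-∙ᵗ varᵗ (choose (Search.repair (Rep.violation (R zero)) d X) (repair-eval (R zero) (small zero) X))))
      (≤-reflexive (sym (+-assoc 40 (repairCost d) rest)))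
      where
      rest = suc k * (40 + repairCost d)
      choose : ∀ ps → unary d ∷ encodeRep (R zero) ∷ encodeSubset X ∷ [] ⊢ body repairᶠ
          ⇓ encodePositions ps [ 0 , just (repairCost d) , 3 ] →
        encodeRep (R zero) ∷ encodeReps (R ∘ suc) ∷ unary d ∷ encodeReps R ∷ encodeSubset X ∷ []
          ⊢ case (call repairᶠ (v2 ∷ v0 ∷ v4 ∷ [])) (call repairsᶠ (v2 ∷ v1 ∷ v4 ∷ [])) (v0 ∙ v1)
          ⇓ encodePositions (ps orElse repairs d (R ∘ suc) X) [ 20 , just (repairCost d + rest) , 3 ]
      choose [] e = pad 20 (case-nilᵗ (callᵗ (varᵗ ∷ᵗ varᵗ ∷ᵗ varᵗ ∷ᵗ []ᵗ) e)
        (callᵗ (varᵗ ∷ᵗ varᵗ ∷ᵗ varᵗ ∷ᵗ []ᵗ) (repairs-loop (R ∘ suc) (small ∘ suc) X)))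
      choose (p ∷ ps) e = weaken {c = 20} {a = just (repairCost d)}
        (pad 20 (case-∙ᵗ (callᵗ (varᵗ ∷ᵗ varᵗ ∷ᵗ varᵗ ∷ᵗ []ᵗ) e) (varᵗ ∙ᵗ varᵗ)))
        (+-monoʳ-≤ 20 (m≤m+n (repairCost d) rest))

    module _ {k} (k<n : suc k ≤ n) (R : Fin k → RepData m) (small : Small R) where

      context : Tree
      context = (nil ∙ unary d) ∙ encodeReps R

      outer-oracle : ∀ X → context ∷ encodeSubset X ∷ [] ⊢ body oracleᶠ
        ⇓ encodePositions (repairs d R X) [ 0 , just (60 + repairCost d) , 4 ]
      outer-oracle X = weaken {c = 20} {a = just (40 + repairCost d)}
        (pad 20 (case-∙ᵗ varᵗ (case-∙ᵗ varᵗ (callᵗ (varᵗ ∷ᵗ varᵗ ∷ᵗ varᵗ ∷ᵗ []ᵗ)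
          (symbolic (scale {K = 40 + repairCost d} k<n (repairs-loop R small X)))))))
        ≤-refl

  module _ {m} (m<n : suc m ≤ n) (d : ℕ) {k} (k<n : suc (suc k) ≤ n) (R : Fin (suc k) → RepData m) (small : Small R)
    (N : ℕ) (few : ∀ ps → length (Enumeration.enum (R zero) ps) ≤ N) where
    open Enumeration (R zero) using (starts; enum)
    open Search (repairs d R)

    private
      w = 3 ^ d * 2
      K = 60 + repairCost d
      zs = spread d starts

    main-eval : (encodeℕ d ∙ encodeReps R) ∷ [] ⊢ mainExpr ⇓ encodeResult (select zs)
      [ 200 , just (mainCost d N (length starts) (length zs)) , 5 ]
    main-eval = subst (λ a → (encodeℕ d ∙ encodeReps R) ∷ [] ⊢ mainExpr ⇓ encodeResult (select zs) [ 200 , just a , 5 ])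
     (sym (mainCost-def d N (length starts) (length zs))) (pad 200 (case-∙ᵗ varᵗ (case-∙ᵗ varᵗ (letᵗ
      (callᵗ (varᵗ ∷ᵗ []ᵗ) (lift z≤n (toUnary-eval d)))
      (case-∙ᵗ varᵗ (letᵗ ((nilᵗ ∙ᵗ varᵗ) ∙ᵗ varᵗ)
        (callᵗ (varᵗ ∷ᵗ callᵗ (varᵗ ∷ᵗ varᵗ ∷ᵗ callᵗ (callᵗ (callᵗ (varᵗ ∷ᵗ []ᵗ) positionsᵉ ∷ᵗ varᵗ ∷ᵗ []ᵗ) enumᵉ ∷ᵗ []ᵗ) firstsᵉ ∷ᵗ []ᵗ) spreadᵉ ∷ᵗ []ᵗ)
          selectᵉ)))))))
      where
      ctx = context m<n d k<n R small
      positionsᵉ : encodeSubset (RepData.U∞ (R zero)) ∷ [] ⊢ body positionsᶠ ⇓ encodePositions (positions m) [ 40 , nothing , 5 ]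
      positionsᵉ = lift (s≤s (s≤s z≤n)) (scale {K = 40} m<n (positions-loop (RepData.U∞ (R zero)) m<n))
      enumᵉ : encodePositions (positions m) ∷ encodeRep (R zero) ∷ [] ⊢ body enumᶠ
        ⇓ encodeStates (enum (positions m)) [ 0 , just (suc N * 1200) , 5 ]
      enumᵉ = symbolic (scale {i = suc (length (positions m))} {K = suc N * 1200}
        (≤-trans (s≤s (≤-reflexive (length-positions m))) m<n)
        (enum-loop (R zero) m<n (small zero) N few (positions m)))
      firstsᵉ : encodeStates (enum (positions m)) ∷ [] ⊢ body firstsᶠ
        ⇓ encodeFamily starts [ 0 , just (suc N * 20) , 5 ]
      firstsᵉ = weaken (lift z≤n (firsts-loop (R zero) m<n (small zero) (enum (positions m))))
        (*-monoˡ-≤ 20 (s≤s (few (positions m))))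
      spreadᵉ : unary d ∷ ctx ∷ encodeFamily starts ∷ [] ⊢ body spreadᶠ
        ⇓ encodeFamily zs [ 0 , just (suc d * (suc (suc w ^ d * length starts) * (20 + candidateCost d))) , 5 ]
      spreadᵉ = lift (n≤1+n 4) (spread-loop m<n ctx (repairs d R) w (repairs-length d R) K 3 (outer-oracle m<n d k<n R small) d starts)
      selectᵉ : ctx ∷ encodeFamily zs ∷ [] ⊢ body selectᶠ ⇓ encodeResult (select zs) [ 0 , just (suc (length zs) * candidateCost d) , 5 ]
      selectᵉ = lift (n≤1+n 4) (select-loop m<n ctx (repairs d R) w (repairs-length d R) K 3 (outer-oracle m<n d k<n R small) zs)

  -- `Computable` asks only for some running time, so costs are no longer tracked.
  pow2-run : ∀ s → ∃[ t ] Defs._⊢_⇓_⟨_⟩ P (unary s ∷ []) (body pow2ᶠ) (unary (2 ^ s)) t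
  pow2-run zero    = _ , ⇓-case-nil (⇓-var _) (⇓-∙ ⇓-nil ⇓-nil)
  pow2-run (suc s) = _ , ⇓-case-∙ (⇓-var _) (⇓-call (⇓-call (⇓-var _ ∷ []) (proj₂ (pow2-run s)) ∷ []) (_⊢_⇓_[_,_,_].eval (double-loop (2 ^ s))))

  inc-run : ∀ s → ∃[ t ] Defs._⊢_⇓_⟨_⟩ P (encodeℕᵇ s ∷ []) (body incᶠ) (encodeℕᵇ (ℕᵇ.suc s)) t
  inc-run ℕᵇ.zero  = _ , ⇓-case-nil (⇓-var _) (⇓-∙ (⇓-∙ ⇓-nil ⇓-nil) ⇓-nil)
  inc-run 2[1+ s ] = _ , ⇓-case-∙ (⇓-var _) (⇓-case-nil (⇓-var _) (⇓-∙ (⇓-∙ ⇓-nil ⇓-nil) (⇓-call (⇓-var _ ∷ []) (proj₂ (inc-run s)))))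
  inc-run 1+[2 s ] = _ , ⇓-case-∙ (⇓-var _) (⇓-case-∙ (⇓-var _) (⇓-∙ ⇓-nil (⇓-var _)))

  -- `fromℕ'` converts by repeated successor, exactly as the program does.
  toBinary-run : ∀ s → ∃[ t ] Defs._⊢_⇓_⟨_⟩ P (unary s ∷ []) (body toBinaryᶠ) (encodeℕᵇ (ℕᵇ.fromℕ' s)) t
  toBinary-run zero    = _ , ⇓-case-nil (⇓-var _) ⇓-nil
  toBinary-run (suc s) = _ , ⇓-case-∙ (⇓-var _)
    (⇓-call (⇓-call (⇓-var _ ∷ []) (proj₂ (toBinary-run s)) ∷ []) (proj₂ (inc-run (ℕᵇ.fromℕ' s))))

  g-run : ∀ d → ∃[ t ] Defs._⊢_⇓_⟨_⟩ P (encodeℕ d ∷ []) gExpr (encodeℕ (g d)) t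
  g-run d = run (g d) refl
    where
    -- g d is generalised to r, lest it be normalised to a unary number.
    run : ∀ r → r ≡ 2 ^ (2 ^ (5 + 2 * d)) → ∃[ t ] Defs._⊢_⇓_⟨_⟩ P (encodeℕ d ∷ []) gExpr (encodeℕ r) t
    run r refl = subst (λ s → ∃[ t ] Defs._⊢_⇓_⟨_⟩ P (encodeℕ d ∷ []) gExpr (encodeℕᵇ s) t) (sym (ℕᵇ.fromℕ≡fromℕ' r))
      (_ , ⇓-call (⇓-call (⇓-call (⇓-∙ ⇓-nil (⇓-∙ ⇓-nil (⇓-∙ ⇓-nil (⇓-∙ ⇓-nil (⇓-∙ ⇓-nil
          (⇓-call (⇓-call (⇓-var _ ∷ []) (_⊢_⇓_[_,_,_].eval (toUnary-eval d)) ∷ []) (_⊢_⇓_[_,_,_].eval (double-loop d))))))) ∷ [])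
        (proj₂ (pow2-run (5 + 2 * d))) ∷ []) (proj₂ (pow2-run (2 ^ (5 + 2 * d)))) ∷ []) (proj₂ (toBinary-run r)))

g-computable : Computable g
-- The size 1 is an arbitrary nonzero choice, as only the evaluation is kept.
g-computable = program gExpr , Evaluation.g-run gExpr 1

tripled : ∀ d → 3 + d + (d + d) ≡ 3 * suc d
tripled = solve-∀

suc≤2^ : ∀ d → suc d ≤ 2 ^ d
suc≤2^ zero    = ≤-refl
suc≤2^ (suc d) = begin
  suc (suc d)        ≤⟨ +-mono-≤ (m^n>0 2 d) (suc≤2^ d) ⟩
  2 ^ d + 2 ^ d      ≡⟨ cong (2 ^ d +_) (+-identityʳ (2 ^ d)) ⟨
  2 ^ suc d          ∎
  where open ≤-Reasoning

-- The bound in terms of d and N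

module Bound (d N s z : ℕ) (1≤N : 1 ≤ N) (s≤N : s ≤ N) (z≤ : z ≤ suc (3 ^ d * 2) ^ d * s) where
  open ≤-Reasoning

  D P c₁ X Y : ℕ
  D  = suc (3 ^ d * 2)
  P  = D ^ d
  c₁ = candidateCost d
  -- One factor `D` pays for the `suc d` rounds, the other two for the cost of a candidate.
  Y  = P * (D * (D * D))
  X  = N * Y

  1≤D : 1 ≤ D
  1≤D = s≤s z≤n

  1≤P : 1 ≤ P
  1≤P = m^n>0 D d

  d<D : suc d ≤ D
  d<D = ≤-trans (suc≤2^ d) (≤-trans (^-monoˡ-≤ d (n≤1+n 2)) (≤-trans (m≤m*n (3 ^ d) 2) (n≤1+n _)))

  _≤*_ : ∀ {a b c e} → a ≤ b → c ≤ e → a * c ≤ b * e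
  _≤*_ = *-mono-≤

  1≤DD : 1 ≤ D * D
  1≤DD = 1≤D ≤* 1≤D

  D≤DD : D ≤ D * D
  D≤DD = m≤m*n D D

  c₁≤ : c₁ ≤ 2560 * (D * D)
  c₁≤ = begin
    c₁                                                        ≤⟨ +-monoʳ-≤ 60 (+-mono-≤ (+-monoʳ-≤ 60 rc) (*-monoˡ-≤ 40 D≤DD)) ⟩
    60 + ((60 + 2400 * (D * D)) + D * D * 40)                 ≤⟨ +-monoˡ-≤ _ (*-monoʳ-≤ 60 1≤DD) ⟩
    60 * (D * D) + ((60 + 2400 * (D * D)) + D * D * 40)       ≤⟨ +-monoʳ-≤ (60 * (D * D)) (+-monoˡ-≤ _ (+-monoˡ-≤ _ (*-monoʳ-≤ 60 1≤DD))) ⟩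
    60 * (D * D) + ((60 * (D * D) + 2400 * (D * D)) + D * D * 40) ≡⟨ regroup (D * D) ⟩
    2560 * (D * D)                                            ∎
    where
    regroup : ∀ q → 60 * q + ((60 * q + 2400 * q) + q * 40) ≡ 2560 * q
    regroup = solve-∀
    rearrange : ∀ D → 3 * D * (D * 800) ≡ 2400 * (D * D)
    rearrange = solve-∀
    rc : (3 + d) * (suc (3 ^ d) * 800) ≤ 2400 * (D * D)
    rc = begin
      (3 + d) * (suc (3 ^ d) * 800)
        ≤⟨ ≤-trans (m≤m+n (3 + d) (d + d)) (≤-trans (≤-reflexive (tripled d)) (*-monoʳ-≤ 3 d<D)) ≤* *-monoˡ-≤ 800 (s≤s (m≤m*n (3 ^ d) 2)) ⟩
      3 * D * (D * 800) ≡⟨ rearrange D ⟩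
      2400 * (D * D)    ∎

  1≤PN : 1 ≤ P * N
  1≤PN = 1≤P ≤* 1≤N

  suc≤2* : ∀ {i j} → i ≤ j → 1 ≤ j → suc i ≤ 2 * j
  suc≤2* {i} {j} i≤j 1≤j = ≤-trans (+-mono-≤ 1≤j i≤j) (≤-reflexive (cong (j +_) (sym (+-identityʳ j))))

  1≤Y : 1 ≤ Y
  1≤Y = 1≤P ≤* (1≤D ≤* 1≤DD)

  1≤X : 1 ≤ X
  1≤X = 1≤N ≤* 1≤Y

  N≤X : N ≤ X
  N≤X = ≤-trans (≤-reflexive (sym (*-identityʳ N))) (*-monoʳ-≤ N 1≤Y)

  D≤X : D ≤ X
  D≤X = begin
    D                      ≡⟨ trans (cong (λ e → 1 * (1 * e)) (*-identityʳ D)) (trans (*-identityˡ (1 * D)) (*-identityˡ D)) ⟨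
    1 * (1 * (D * 1))      ≤⟨ 1≤N ≤* (1≤P ≤* *-monoʳ-≤ D 1≤DD) ⟩
    X                      ∎

  cost≤ : 200 + mainCost d N s z ≤ 2 ^ 14 * X
  cost≤ = begin
    200 + mainCost d N s z
      ≡⟨ cong (200 +_) (mainCost-def d N s z) ⟩
    200 + (suc d * 60 + (suc N * 1200 + suc N * 20 + suc d * (suc (P * s) * (20 + c₁)) + suc z * c₁))
      ≤⟨ +-mono-≤ (*-monoʳ-≤ 200 1≤X) (+-mono-≤ (*-monoˡ-≤ 60 (≤-trans d<D D≤X))
           (+-mono-≤ (+-mono-≤ (+-mono-≤ (*-monoˡ-≤ 1200 sucN≤) (*-monoˡ-≤ 20 sucN≤)) spread≤) select≤)) ⟩
    200 * X + (X * 60 + (2 * X * 1200 + 2 * X * 20 + 5160 * X + 5120 * X))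
      ≡⟨ regroup X ⟩
    12980 * X
      -- A power of two can join the exponent of `g`.
      ≤⟨ *-monoˡ-≤ X (≤ᵇ⇒≤ 12980 (2 ^ 14) _) ⟩
    2 ^ 14 * X ∎
    where
    regroup : ∀ X → 200 * X + (X * 60 + (2 * X * 1200 + 2 * X * 20 + 5160 * X + 5120 * X)) ≡ 12980 * X
    regroup = solve-∀
    sucN≤ : suc N ≤ 2 * X
    sucN≤ = ≤-trans (suc≤2* ≤-refl 1≤N) (*-monoʳ-≤ 2 N≤X)
    rearrange₁ : ∀ D P N → D * (2 * (P * N) * (2580 * (D * D))) ≡ 5160 * (N * (P * (D * (D * D))))
    rearrange₁ = solve-∀
    rearrange₂ : ∀ P N Q → 2 * (P * N) * (2560 * Q) ≡ 5120 * (N * (P * Q))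
    rearrange₂ = solve-∀
    spread≤ : suc d * (suc (P * s) * (20 + c₁)) ≤ 5160 * X
    spread≤ = begin
      suc d * (suc (P * s) * (20 + c₁))
        ≤⟨ d<D ≤* (suc≤2* (*-monoʳ-≤ P s≤N) 1≤PN ≤* +-mono-≤ (*-monoʳ-≤ 20 1≤DD) c₁≤) ⟩
      D * (2 * (P * N) * (20 * (D * D) + 2560 * (D * D)))
        ≡⟨ cong (λ e → D * (2 * (P * N) * e)) (*-distribʳ-+ (D * D) 20 2560) ⟨
      D * (2 * (P * N) * (2580 * (D * D)))
        ≡⟨ rearrange₁ D P N ⟩
      5160 * X ∎
    select≤ : suc z * c₁ ≤ 5120 * X
    select≤ = begin
      suc z * c₁                           ≤⟨ suc≤2* (≤-trans z≤ (*-monoʳ-≤ P s≤N)) 1≤PN ≤* c₁≤ ⟩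
      2 * (P * N) * (2560 * (D * D))       ≡⟨ rearrange₂ P N (D * D) ⟩
      5120 * (N * (P * (D * D)))           ≤⟨ *-monoʳ-≤ 5120 (*-monoʳ-≤ N (*-monoʳ-≤ P (m≤n*m (D * D) D))) ⟩
      5120 * X                             ∎

  D≤2^ : D ≤ 2 ^ (2 * suc d)
  D≤2^ = begin
    1 + 3 ^ d * 2            ≤⟨ +-monoˡ-≤ _ (m^n>0 3 d) ⟩
    3 ^ d + 3 ^ d * 2        ≤⟨ m≤n+m _ (3 ^ d) ⟩
    3 ^ d + (3 ^ d + 3 ^ d * 2) ≡⟨ regroup (3 ^ d) ⟩
    4 * 3 ^ d                ≤⟨ *-monoʳ-≤ 4 (^-monoˡ-≤ d (n≤1+n 3)) ⟩
    4 ^ suc d                ≡⟨ ^-*-assoc 2 2 (suc d) ⟩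
    2 ^ (2 * suc d)          ∎
    where
    regroup : ∀ q → q + (q + q * 2) ≡ 4 * q
    regroup = solve-∀

  -- With `h = 2 ^ d`, which is at least `suc d`, the left side is at most `20 * (h * h)`. Rounding
  -- 20 up to 32 gives the 5 in `g`, and `h * h` gives the `2 * d`.
  exponent : 14 + 2 * suc d * (3 + d) ≤ 2 ^ (5 + 2 * d)
  exponent = begin
    14 + 2 * suc d * (3 + d)      ≤⟨ +-monoʳ-≤ 14 (*-monoʳ-≤ (2 * suc d) (≤-trans (m≤m+n (3 + d) (d + d)) (≤-reflexive (tripled d)))) ⟩
    14 + 2 * suc d * (3 * suc d)  ≤⟨ +-mono-≤ (*-monoʳ-≤ 14 (m^n>0 2 d ≤* m^n>0 2 d)) (*-monoʳ-≤ 2 (suc≤2^ d) ≤* *-monoʳ-≤ 3 (suc≤2^ d)) ⟩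
    14 * (h * h) + 2 * h * (3 * h) ≤⟨ m≤m+n _ (12 * (h * h)) ⟩
    14 * (h * h) + 2 * h * (3 * h) + 12 * (h * h) ≡⟨ regroup h ⟩
    32 * (h * h)                  ≡⟨ cong (32 *_) (trans (cong (2 ^_) (cong (d +_) (+-identityʳ d))) (^-distribˡ-+-* 2 d d)) ⟨
    32 * 2 ^ (2 * d)              ≡⟨ ^-distribˡ-+-* 2 5 (2 * d) ⟨
    2 ^ (5 + 2 * d)               ∎
    where
    h = 2 ^ d
    regroup : ∀ h → 14 * (h * h) + 2 * h * (3 * h) + 12 * (h * h) ≡ 32 * (h * h)
    regroup = solve-∀

  2^*X≤ : ∀ a → 2 ^ a * X ≤ N * 2 ^ (a + 2 * suc d * (3 + d))
  2^*X≤ a = begin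
    2 ^ a * (N * Y)                               ≡⟨ rearrange (2 ^ a) N D P ⟩
    N * (2 ^ a * D ^ (3 + d))                     ≤⟨ *-monoʳ-≤ N (*-monoʳ-≤ (2 ^ a) (^-monoˡ-≤ (3 + d) D≤2^)) ⟩
    N * (2 ^ a * (2 ^ (2 * suc d)) ^ (3 + d))     ≡⟨ cong (λ e → N * (2 ^ a * e)) (^-*-assoc 2 (2 * suc d) (3 + d)) ⟩
    N * (2 ^ a * 2 ^ (2 * suc d * (3 + d)))       ≡⟨ cong (N *_) (^-distribˡ-+-* 2 a (2 * suc d * (3 + d))) ⟨
    N * 2 ^ (a + 2 * suc d * (3 + d))             ∎
    where
    rearrange : ∀ c N D P → c * (N * (P * (D * (D * D)))) ≡ N * (c * (D * (D * (D * P))))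
    rearrange = solve-∀

  2^14*X≤ : 2 ^ 14 * X ≤ N * g d
  2^14*X≤ = ≤-trans (2^*X≤ 14) (*-monoʳ-≤ N (^-monoʳ-≤ 2 exponent))

-- Loop lengths are below the input size.

size-subset : ∀ {m} (X : Subset m) → suc m ≤ size (encodeSubset X)
size-subset []      = ≤-refl
size-subset (x ∷ X) = s≤s (≤-trans (size-subset X) (m≤n+m _ (size (encodeBool x))))

size-list : ∀ {k} (t : Fin k → Tree) → suc k ≤ size (encodeList (List.tabulate t))
size-list {zero}  t = ≤-refl
size-list {suc k} t = s≤s (≤-trans (size-list (t ∘ suc)) (m≤n+m _ (size (t zero))))

size-∈list : ∀ {k} (t : Fin k → Tree) i → size (t i) ≤ size (encodeList (List.tabulate t))
size-∈list t zero    = ≤-trans (m≤m+n _ _) (n≤1+n _)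
size-∈list t (suc i) = ≤-trans (size-∈list (t ∘ suc) i) (≤-trans (m≤n+m _ (size (t zero))) (n≤1+n _))

-- Correctness and running time on an instance.

module _ (I : Instance) where
  open Instance I
  open Rep (rep zero) using (Feasible; member⇒feasible; feasible⇒member)
  open Enumeration (rep zero) using (members; starts; starts-complete; enum-length; feasible?)

  reps : Tree
  reps = encodeList (List.tabulate λ i → encodeRep (rep i))

  reps≤ : size reps ≤ ∣ I ∣ᴵ
  reps≤ = ≤-trans (m≤n+m _ (size (encodeℕ d))) (n≤1+n _)

  m<n : suc m ≤ ∣ I ∣ᴵ
  m<n = ≤-trans (size-subset (RepData.U∞ (rep zero))) (≤-trans (≤-trans (m≤m+n _ _) (n≤1+n _))
    (≤-trans (size-∈list (λ i → encodeRep (rep i)) zero) reps≤))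

  k<n : suc (suc k-1) ≤ ∣ I ∣ᴵ
  k<n = ≤-trans (size-list (λ i → encodeRep (rep i))) reps≤

  b<n : ∀ i → suc (suc (RepData.b (rep i))) ≤ ∣ I ∣ᴵ
  b<n i = ≤-trans (size-list (λ j → encodeSubset (RepData.U (rep i) j))) (≤-trans (m≤m+n _ _) (≤-trans (n≤1+n _)
    (≤-trans (m≤n+m _ (size (encodeSubset (RepData.U∞ (rep i))))) (≤-trans (n≤1+n _) (≤-trans (size-∈list (λ i → encodeRep (rep i)) i) reps≤)))))

  N : ℕ
  N = length members

  oracle : Subset m → List (Fin m)
  oracle = repairs d rep

  open Search oracle

  result : Maybe (Subset m)
  result = select (spread d starts)

  minimizer : ∃[ Y ] Feasible Y
  minimizer with Rep.nonempty (rep zero) (isRep zero)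
  ... | Y , min = Y , member⇒feasible (isRep zero) min

  N-cardinality : HasCardinality (ArgMin (f zero)) N
  N-cardinality = members , Unique.filter⁺ feasible? (subsets-unique m)
    , (λ Y → mk⇔ (λ Y∈ → feasible⇒member (isRep zero) (proj₂ (∈-filter⁻ feasible? {xs = subsets m} Y∈)))
                  (λ min → ∈-filter⁺ feasible? (∈-subsets Y) (member⇒feasible (isRep zero) min)))
    , refl

  oracle-sound : ∀ X → oracle X ≡ [] → IsSolution X
  oracle-sound X eq i with Search.repair-sound (Rep.violation (rep i)) d X (firstNonempty≡[] (suc k-1) {λ i → Search.repair (Rep.violation (rep i)) d X} eq i)
  ... | Y , good , near = Y , Rep.feasible⇒member (rep i) (isRep i) (Rep.violation≡[]⇒feasible (rep i) Y good) , near

  oracle-hits : ∀ X → IsSolution X → ∀ Y → Hits X Y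
  oracle-hits X sol Y = firstNonempty-either (suc k-1) (λ ps → ∃[ p ] p ∈ˡ ps × Differ Y X p) λ i →
    let Z , min , near = sol i in
    Search.repair-hits (Rep.violation (rep i)) d Y X Z
      (Rep.violation-hits (rep i) (Rep.member⇒feasible (rep i) (isRep i) min)) near

  -- A solution `X` lies within distance `d` of a minimizer `Y` of the first function, and `Y` is a
  -- start. With `Y` in both roles of `spread-complete`, a difference between the two is impossible,
  -- so the search must meet an accepted set.
  unsolvable : result ≡ nothing → ∀ X → ¬ IsSolution X
  unsolvable eq X sol with sol zero
  ... | Y , min , near with spread-complete d Y Y X (oracle-hits X sol) (starts-complete (member⇒feasible (isRep zero) min))
                              (≤-trans (≤-reflexive (dist-sym Y X)) near)
  ...   | Z , Z∈ , inj₁ good            = select-nothing (spread d starts) eq Z∈ good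
  ...   | Z , Z∈ , inj₂ (p , p∈ , diff) = diff refl

  correct : ∀ r → result ≡ r → Correct I r
  correct (just X) eq = found (oracle-sound X (proj₂ (select-just (spread d starts) eq)))
  correct nothing  eq = none (unsolvable eq)

  few : ∀ ps → length (Enumeration.enum (rep zero) ps) ≤ N
  few ps = enum-length ps (proj₂ minimizer)

  run : Evaluation._⊢_⇓_[_,_,_] mainExpr ∣ I ∣ᴵ (encodeInstance I ∷ []) mainExpr (encodeResult result)
    200 (just (mainCost d N (length starts) (length (spread d starts)))) 5
  run = Evaluation.main-eval mainExpr ∣ I ∣ᴵ m<n d k<n rep b<n N few

  time≤ : Evaluation._⊢_⇓_[_,_,_].time run ≤ N * g d * ∣ I ∣ᴵ ^ 5
  time≤ = ≤-trans (Evaluation._≤[_,_,_].get (Evaluation._⊢_⇓_[_,_,_].bound run)) (*-monoˡ-≤ (∣ I ∣ᴵ ^ 5) (≤-trans cost≤ 2^14*X≤))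
    where
    open Bound d N (length starts) (length (spread d starts))
      (∈-length (∈-filter⁺ feasible? (∈-subsets _) (proj₂ minimizer)))
      (≤-trans (≤-reflexive (length-map proj₁ (Enumeration.enum (rep zero) (positions m)))) (few (positions m)))
      (SearchLength.spread-length oracle (3 ^ d * 2) (repairs-length d rep) d starts)

theorem5p13 : ∃[ c ] ∃[ g ] Computable g × (∃[ P ] ∀ (I : Instance) →
    let open Instance I in
    ∃[ result ] ∃[ t ] ∃[ N ]
    Runs P (encodeInstance I) (encodeResult result) t ×
    Correct I result ×
    HasCardinality (ArgMin (f zero)) N ×
    t ≤ N * g d * ∣ I ∣ᴵ ^ c)
-- The exponent 5 counts the nested loops of the enumeration: positions, rounds of closure, blocks,
-- successors of a block, elements. The search has four: functions, blocks, successors, elements.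
theorem5p13 = 5 , g , g-computable , program mainExpr , λ I →
  result I , _ , N I , Evaluation._⊢_⇓_[_,_,_].eval (run I) , correct I _ refl , N-cardinality I , time≤ I
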